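{- Let $q=2^h$ with $h$ odd, and let $U=\{(x,\,y,\,x^q+y^{q^2},\,x^{q^2}+y^q+y^{q^2}) : x,y\in\mathbb{F}_{q^4}\}\subseteq\mathbb{F}_{q^4}^4$. Then $U$ is $(2,3)_q$-evasive, i.e. $\dim_{\mathbb{F}_q}(U\cap H)\le 3$ for every $2$-dimensional $\mathbb{F}_{q^4}$-subspace $H$ of $\mathbb{F}_{q^4}^4$.
   Context: For an $\mathbb{F}_q$-subspace $U$ of $\mathbb{F}_{q^m}^k$ and integers $0\le h<k$, $r$, $U$ is $(h,r)_q$-evasive if $\dim_{\mathbb{F}_q}(U\cap H)\le r$ for every $h$-dimensional $\mathbb{F}_{q^m}$-subspace $H$ of $\mathbb{F}_{q^m}^k$. -}

module Defs where

open import Level using (Level; _⊔_) renaming (suc to lsuc)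
open import Data.Nat using (ℕ; zero; suc)
import Data.Nat
open import Data.Fin using (Fin; zero; suc)
open import Data.Product using (Σ; ∃; ∃-syntax; _×_; _,_)
open import Relation.Nullary using (¬_)
open import Relation.Binary.PropositionalEquality as ≡ using (_≡_)
open import Algebra.Bundles using (CommutativeRing)
open import Function.Bundles using (Inverse)

record Field (c ℓ : Level) : Set (lsuc (c ⊔ ℓ)) where
  field
    commutativeRing : CommutativeRing c ℓ
  open CommutativeRing commutativeRing public
  field
    0≉1     : ¬ (0# ≈ 1#)
    inverse : ∀ x → ¬ (x ≈ 0#) → ∃[ y ] (x * y ≈ 1#)

module FieldOps {c ℓ : Level} (K : Field c ℓ) where
  open Field K using (Carrier; _≈_; _+_; _*_; 0#; 1#)

  pow : Carrier → ℕ → Carrier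
  pow x zero    = 1#
  pow x (suc n) = x * pow x n

  Vect : ℕ → Set c
  Vect n = Fin n → Carrier

  _≈ᵛ_ : ∀ {n} → Vect n → Vect n → Set ℓ
  u ≈ᵛ v = ∀ i → u i ≈ v i

  _+ᵛ_ : ∀ {n} → Vect n → Vect n → Vect n
  (u +ᵛ v) i = u i + v i

  _·ᵛ_ : ∀ {n} → Carrier → Vect n → Vect n
  (a ·ᵛ v) i = a * v i

  0ᵛ : ∀ {n} → Vect n
  0ᵛ i = 0#

  lincomb : ∀ {m n} → (Fin m → Carrier) → (Fin m → Vect n) → Vect n
  lincomb {zero}  c v = 0ᵛ
  lincomb {suc m} c v = (c zero ·ᵛ v zero) +ᵛ lincomb (λ j → c (suc j)) (λ j → v (suc j))

  InSpan : ∀ {h n} → (Fin h → Vect n) → Vect n → Set (c ⊔ ℓ)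
  InSpan b v = ∃[ α ] (v ≈ᵛ lincomb α b)

  LinIndep : ∀ {h n} → (Fin h → Vect n) → Set (c ⊔ ℓ)
  LinIndep b = ∀ α → lincomb α b ≈ᵛ 0ᵛ → ∀ j → α j ≈ 0#

  InFq : ℕ → Carrier → Set ℓ
  InFq q x = pow x q ≈ x

  -- dim_{F_q}(W) ≤ r for an F_q-subspace W ⊆ K^n given by a predicate:
  -- any r+1 vectors of W are F_q-linearly dependent
  DimFqLe : ∀ {n} → ℕ → (Vect n → Set (c ⊔ ℓ)) → ℕ → Set (c ⊔ ℓ)
  DimFqLe q W r = (v : Fin (suc r) → Vect _) → (∀ j → W (v j)) →
    ∃[ γ ] ((∀ j → InFq q (γ j)) × (∃[ j ] ¬ (γ j ≈ 0#)) × (lincomb γ v ≈ᵛ 0ᵛ))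

  -- U ⊆ K^k is (h,r)_q-evasive: dim_{F_q}(U ∩ H) ≤ r for every h-dimensional
  -- K-subspace H (given as the span of h K-linearly independent vectors)
  Evasive : ℕ → (k : ℕ) → (Vect k → Set (c ⊔ ℓ)) → ℕ → ℕ → Set (c ⊔ ℓ)
  Evasive q k U h r = (b : Fin h → Vect k) → LinIndep b →
    DimFqLe q (λ v → U v × InSpan b v) r

HasCard : ∀ {c ℓ} → Field c ℓ → ℕ → Set (c ⊔ ℓ)
HasCard K n = Inverse (Field.setoid K) (≡.setoid (Fin n))

module PaperU {c ℓ : Level} (K : Field c ℓ) (q : ℕ) where
  open Field K using (Carrier; _≈_; _+_; _*_; 0#; 1#)
  open FieldOps K

  uVec : Carrier → Carrier → Vect 4
  uVec x y zero                   = x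
  uVec x y (suc zero)             = y
  uVec x y (suc (suc zero))       = pow x q + pow y (q Data.Nat.* q)
  uVec x y (suc (suc (suc zero))) = pow x (q Data.Nat.* q) + pow y q + pow y (q Data.Nat.* q)

  U : Vect 4 → Set (c ⊔ ℓ)
  U v = ∃[ x ] ∃[ y ] (v ≈ᵛ uVec x y)

-- Suppose H contains four vectors of U, with coordinates (xⱼ, yⱼ). By Galois descent they are
-- 𝔽_q-dependent as soon as some nonzero α over K kills all Frobenius conjugates of both
-- coordinates. If H is the graph of a linear map (x, y) ↦ (z, w), its equations are a
-- second-order Frobenius recurrence for (x, y), so it suffices that α kills (x, y, x^q, y^q).
-- Going once around the cycle, x^(q⁴) = x and y^(q⁴) = y, yields linear equations on these four
-- quantities. If one is nontrivial, α exists; if all are trivial, K has an element t with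
-- t⁴ = t + 1 = t^q, which is impossible for q an odd power of two. If H is not a graph, (x, y)
-- runs over multiples λ (u, v) with λ subject to a recurrence, which degenerates only if
-- t = u / v satisfies t^(q+1) = t + 1, that is, t ∈ 𝔽_q and t² = t + 1, again impossible.
module Submission where

open import Defs
open import Level using (Level)
open import Algebra.Bundles using (CommutativeRing; RawRing)
open import Data.Bool.Base using (Bool; true; false)
open import Data.Bool.Properties using (xor-∧-commutativeRing)
import Data.Bool.Properties as Bool
open import Data.Empty using (⊥-elim)
open import Data.Fin using (Fin; zero; suc; punchIn; punchOut)
import Data.Fin.Properties as Fin
open import Data.Fin.Permutation using (Permutation; permutation)
open import Data.Fin.Patterns using (0F; 1F; 2F; 3F)
open import Data.Maybe.Base using (Maybe; just; nothing)
open import Data.Nat using (ℕ; zero; suc)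
import Data.Nat as ℕ
import Data.Nat.Properties as ℕ
open import Data.Product using (∃-syntax; _×_; _,_; proj₁; proj₂)
open import Data.Sum using (_⊎_; inj₁; inj₂)
open import Data.Vec.Functional using (insertAt; removeAt; _∷_; [])
open import Data.Vec.Functional.Properties using (insertAt-lookup; insertAt-punchIn)
open import Function using (_∘_)
open import Function.Bundles using (Inverse)
open import Relation.Binary.Definitions using (Decidable)
open import Relation.Binary.PropositionalEquality as ≡ using (_≡_; _≢_)
open import Relation.Nullary using (¬_; yes; no; contradiction)
open import Relation.Nullary.Decidable using (map′)

-- Linear systems over a field with decidable equality.

module LinearAlgebra {c ℓ : Level} (K : Field c ℓ) (_≟_ : Decidable (Field._≈_ K)) where
  open Field K hiding (zero)
  open FieldOps K
  open import Algebra.Properties.Ring ring using (-‿distribˡ-*)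
  open import Algebra.Properties.Semiring.Sum semiring
    using (sum; sum-cong-≋; sum-remove; ∑-distrib-+; *-distribˡ-sum; ∑-comm)
  open import Relation.Binary.Reasoning.Setoid setoid

  zero-product : ∀ x y → x * y ≈ 0# → x ≈ 0# ⊎ y ≈ 0#
  zero-product x y xy≈0 with x ≟ 0#
  ... | yes x≈0 = inj₁ x≈0
  ... | no x≉0 = inj₂ (begin
    y            ≈⟨ *-identityˡ y ⟨
    1# * y       ≈⟨ *-congʳ xx⁻¹≈1 ⟨
    x * x⁻¹ * y  ≈⟨ *-congʳ (*-comm x x⁻¹) ⟩
    x⁻¹ * x * y  ≈⟨ *-assoc x⁻¹ x y ⟩
    x⁻¹ * (x * y) ≈⟨ *-congˡ xy≈0 ⟩
    x⁻¹ * 0#     ≈⟨ zeroʳ x⁻¹ ⟩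
    0#           ∎)
    where
    x⁻¹ = proj₁ (inverse x x≉0)
    xx⁻¹≈1 = proj₂ (inverse x x≉0)

  cancel-zero : ∀ {x y} → ¬ (x ≈ 0#) → x * y ≈ 0# → y ≈ 0#
  cancel-zero {x} {y} x≉0 xy≈0 with zero-product x y xy≈0
  ... | inj₁ x≈0 = contradiction x≈0 x≉0
  ... | inj₂ y≈0 = y≈0

  Nontrivial : ∀ {n} → Vect n → Set ℓ
  Nontrivial α = ∃[ j ] ¬ (α j ≈ 0#)

  zero-or-nontrivial : ∀ {n} (α : Vect n) → α ≈ᵛ 0ᵛ ⊎ Nontrivial α
  zero-or-nontrivial α with Fin.all? (λ j → α j ≟ 0#)
  ... | yes α≈0 = inj₁ α≈0
  ... | no  α≉0 = inj₂ (Fin.¬∀⟶∃¬ _ _ (λ j → α j ≟ 0#) α≉0)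

  infix 8 _·_
  _·_ : ∀ {n} → Vect n → Vect n → Carrier
  α · x = sum (λ j → α j * x j)

  ·-cong : ∀ {n} {α β x y : Vect n} → α ≈ᵛ β → x ≈ᵛ y → α · x ≈ β · y
  ·-cong α≈β x≈y = sum-cong-≋ (λ j → *-cong (α≈β j) (x≈y j))

  ·-congˡ : ∀ {n} {α x y : Vect n} → x ≈ᵛ y → α · x ≈ α · y
  ·-congˡ {α = α} = ·-cong {α = α} (λ _ → refl)

  ·-distribˡ : ∀ {n} (α x y : Vect n) → α · (x +ᵛ y) ≈ α · x + α · y
  ·-distribˡ α x y = begin
    α · (x +ᵛ y)                        ≈⟨ sum-cong-≋ (λ j → distribˡ (α j) (x j) (y j)) ⟩
    sum (λ j → α j * x j + α j * y j)   ≈⟨ ∑-distrib-+ (λ j → α j * x j) (λ j → α j * y j) ⟩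
    α · x + α · y                       ∎

  ·-scaleʳ : ∀ {n} (α x : Vect n) k → α · (k ·ᵛ x) ≈ k * α · x
  ·-scaleʳ α x k = begin
    α · (k ·ᵛ x)                   ≈⟨ sum-cong-≋ (λ j → swap (α j) (x j)) ⟩
    sum (λ j → k * (α j * x j))    ≈⟨ *-distribˡ-sum k (λ j → α j * x j) ⟨
    k * α · x                      ∎
    where
    swap : ∀ a b → a * (k * b) ≈ k * (a * b)
    swap a b = begin
      a * (k * b) ≈⟨ *-assoc a k b ⟨
      a * k * b   ≈⟨ *-congʳ (*-comm a k) ⟩
      k * a * b   ≈⟨ *-assoc k a b ⟩
      k * (a * b) ∎

  ·-comm : ∀ {n} (α x : Vect n) → α · x ≈ x · α
  ·-comm α x = sum-cong-≋ (λ j → *-comm (α j) (x j))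

  ·-zeroʳ : ∀ {n} (α : Vect n) {x : Vect n} → x ≈ᵛ 0ᵛ → α · x ≈ 0#
  ·-zeroʳ {zero}  α x≈0 = refl
  ·-zeroʳ {suc n} α x≈0 = trans
    (+-cong (trans (*-congˡ (x≈0 zero)) (zeroʳ _)) (·-zeroʳ (α ∘ suc) (x≈0 ∘ suc))) (+-identityˡ 0#)

  ·-scale-zeroʳ : ∀ {n} (α x : Vect n) k → α · x ≈ 0# → α · (k ·ᵛ x) ≈ 0#
  ·-scale-zeroʳ α x k αx≈0 = trans (·-scaleʳ α x k) (trans (*-congˡ αx≈0) (zeroʳ k))

  ·-sum-zeroʳ : ∀ {n} (α x y : Vect n) → α · x ≈ 0# → α · y ≈ 0# → α · (x +ᵛ y) ≈ 0#
  ·-sum-zeroʳ α x y αx≈0 αy≈0 = trans (·-distribˡ α x y) (trans (+-cong αx≈0 αy≈0) (+-identityˡ 0#))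

  ·-scale-zeroˡ : ∀ {n} (α x : Vect n) k → α · x ≈ 0# → (k ·ᵛ α) · x ≈ 0#
  ·-scale-zeroˡ α x k αx≈0 =
    trans (·-comm (k ·ᵛ α) x) (·-scale-zeroʳ x α k (trans (·-comm x α) αx≈0))

  ·-sum-zeroˡ : ∀ {n} (α β x : Vect n) → α · x ≈ 0# → β · x ≈ 0# → (α +ᵛ β) · x ≈ 0#
  ·-sum-zeroˡ α β x αx≈0 βx≈0 =
    trans (·-comm (α +ᵛ β) x) (·-sum-zeroʳ x α β (trans (·-comm x α) αx≈0) (trans (·-comm x β) βx≈0))

  -- Both sides are the double sum of ρₖ αⱼ wₖⱼ. This is the passage between relations among the
  -- rows and relations among the columns of the matrix `w`.
  ·-exchange : ∀ {m n} (ρ : Vect m) (α : Vect n) (w : Fin m → Vect n) →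
               ρ · (λ k → α · w k) ≈ α · (λ j → ρ · (λ k → w k j))
  ·-exchange ρ α w = begin
    sum (λ k → ρ k * sum (λ j → α j * w k j))
      ≈⟨ sum-cong-≋ (λ k → *-distribˡ-sum (ρ k) (λ j → α j * w k j)) ⟩
    sum (λ k → sum (λ j → ρ k * (α j * w k j)))
      ≈⟨ ∑-comm (λ k j → ρ k * (α j * w k j)) ⟩
    sum (λ j → ρ · (λ k → α j * w k j))
      ≈⟨ sum-cong-≋ (λ j → ·-scaleʳ ρ (λ k → w k j) (α j)) ⟩
    α · (λ j → ρ · (λ k → w k j)) ∎

  ·-remove : ∀ {n} (α x : Vect (suc n)) p → α · x ≈ α p * x p + removeAt α p · removeAt x p
  ·-remove α x p = sum-remove {i = p} (λ j → α j * x j)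

  ·-insertAt : ∀ {n} (α : Vect n) (x : Vect (suc n)) p k →
               insertAt α p k · x ≈ k * x p + α · removeAt x p
  ·-insertAt α x p k = begin
    insertAt α p k · x
      ≈⟨ ·-remove (insertAt α p k) x p ⟩
    insertAt α p k p * x p + removeAt (insertAt α p k) p · removeAt x p
      ≈⟨ +-cong (*-congʳ (reflexive (insertAt-lookup α p k)))
                (·-cong (λ j → reflexive (insertAt-punchIn α p k j)) (λ _ → refl)) ⟩
    k * x p + α · removeAt x p ∎

  ·-insertAt-0 : ∀ {n} (α : Vect n) (x : Vect (suc n)) p → insertAt α p 0# · x ≈ α · removeAt x p
  ·-insertAt-0 α x p =
    trans (·-insertAt α x p 0#) (trans (+-congʳ (zeroˡ (x p))) (+-identityˡ _))

  insertAt-nontrivial : ∀ {n} {α : Vect n} p k → Nontrivial α → Nontrivial (insertAt α p k)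
  insertAt-nontrivial {α = α} p k (j , αⱼ≉0) =
    punchIn p j , λ eq → αⱼ≉0 (trans (sym (reflexive (insertAt-punchIn α p k j))) eq)

  removeAt-nontrivial : ∀ {n} {α : Vect (suc n)} p → α p ≈ 0# → Nontrivial α → Nontrivial (removeAt α p)
  removeAt-nontrivial {α = α} p αₚ≈0 (j , αⱼ≉0) = punchOut p≢j , λ eq →
    αⱼ≉0 (trans (sym (reflexive (≡.cong α (Fin.punchIn-punchOut p≢j)))) eq)
    where
    p≢j : p ≢ j
    p≢j ≡.refl = αⱼ≉0 αₚ≈0

  -- Gaussian elimination by induction on `n`. If the first row is zero, the unknown 0 is set to 0
  -- and the remaining rows are solved; otherwise a nonzero entry of the first row serves as pivot.
  underdetermined-system : ∀ n (w : Fin n → Vect (suc n)) →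
    ∃[ α ] (Nontrivial α × (∀ k → α · w k ≈ 0#))
  underdetermined-system zero    w = (λ _ → 1#) , (zero , λ eq → 0≉1 (sym eq)) , λ ()
  underdetermined-system (suc n) w with zero-or-nontrivial (w zero)
  ... | inj₁ w₀≈0 = insertAt β zero 0# , insertAt-nontrivial {α = β} zero 0# β≉0 , λ
    { zero    → ·-zeroʳ (insertAt β zero 0#) w₀≈0
    ; (suc k) → trans (·-insertAt-0 β (w (suc k)) zero) (βw≈0 k) }
    where
    solution = underdetermined-system n (λ k → removeAt (w (suc k)) zero)
    β = proj₁ solution
    β≉0 = proj₁ (proj₂ solution)
    βw≈0 = proj₂ (proj₂ solution)
  ... | inj₂ (p , w₀ₚ≉0) = insertAt β p b , insertAt-nontrivial {α = β} p b β≉0 , λ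
    { zero    → begin
        insertAt β p b · w zero   ≈⟨ ·-insertAt β (w zero) p b ⟩
        b * w zero p + s          ≈⟨ +-congʳ (begin
          - (s * i) * w zero p      ≈⟨ -‿distribˡ-* (s * i) (w zero p) ⟨
          - (s * i * w zero p)      ≈⟨ -‿cong (trans (*-assoc s i (w zero p)) (*-congˡ (*-comm i (w zero p)))) ⟩
          - (s * (w zero p * i))    ≈⟨ -‿cong (trans (*-congˡ w₀ₚi≈1) (*-identityʳ s)) ⟩
          - s                       ∎) ⟩
        - s + s                   ≈⟨ -‿inverseˡ s ⟩
        0#                        ∎
    ; (suc k) → begin
        insertAt β p b · w (suc k)   ≈⟨ ·-insertAt β (w (suc k)) p b ⟩
        b * w (suc k) p + β · removeAt (w (suc k)) p
          ≈⟨ trans (+-comm _ _) (+-congˡ (begin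
               - (s * i) * w (suc k) p   ≈⟨ -‿distribˡ-* (s * i) (w (suc k) p) ⟨
               - (s * i * w (suc k) p)   ≈⟨ -‿cong (trans (*-assoc s i _) (*-comm s _)) ⟩
               - (i * w (suc k) p * s)   ≈⟨ -‿distribˡ-* _ s ⟩
               m k * s                   ≈⟨ ·-scaleʳ β (removeAt (w zero) p) (m k) ⟨
               β · (m k ·ᵛ removeAt (w zero) p) ∎)) ⟩
        β · removeAt (w (suc k)) p + β · (m k ·ᵛ removeAt (w zero) p)
          ≈⟨ ·-distribˡ β (removeAt (w (suc k)) p) (m k ·ᵛ removeAt (w zero) p) ⟨
        β · (removeAt (w (suc k)) p +ᵛ (m k ·ᵛ removeAt (w zero) p))
          ≈⟨ βw≈0 k ⟩
        0# ∎ }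
    where
    i = proj₁ (inverse (w zero p) w₀ₚ≉0)
    w₀ₚi≈1 = proj₂ (inverse (w zero p) w₀ₚ≉0)
    -- The multiple of the first row that clears column `p` of row `suc k`.
    m : Fin n → Carrier
    m k = - (i * w (suc k) p)
    solution = underdetermined-system n
      (λ k → removeAt (w (suc k)) p +ᵛ (m k ·ᵛ removeAt (w zero) p))
    β = proj₁ solution
    β≉0 = proj₁ (proj₂ solution)
    βw≈0 = proj₂ (proj₂ solution)
    -- With the other unknowns given by `β`, the first row determines the pivot unknown as `b`.
    s = β · removeAt (w zero) p
    b = - (s * i)

  -- The relation `ρ` makes row `p`, where `ρ p` is nonzero, a combination of the others. Dropping
  -- that row leaves fewer equations than unknowns, and a solution of the rest satisfies row `p`
  -- automatically.
  singular-system : ∀ n (ρ : Vect (suc n)) → Nontrivial ρ → (w : Fin (suc n) → Vect (suc n)) →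
    (∀ j → ρ · (λ k → w k j) ≈ 0#) → ∃[ α ] (Nontrivial α × (∀ k → α · w k ≈ 0#))
  singular-system n ρ (p , ρₚ≉0) w ρw≈0 = α , α≉0 , λ k → all-rows k
    where
    solution = underdetermined-system n (removeAt w p)
    α = proj₁ solution
    α≉0 = proj₁ (proj₂ solution)
    dots : Vect (suc n)
    dots k = α · w k
    removed≈0 : removeAt ρ p · removeAt dots p ≈ 0#
    removed≈0 = ·-zeroʳ (removeAt ρ p) (proj₂ (proj₂ solution))
    ρdots≈0 : ρ · dots ≈ 0#
    ρdots≈0 = trans (·-exchange ρ α w) (·-zeroʳ α ρw≈0)
    pivot≈0 : dots p ≈ 0#
    pivot≈0 = cancel-zero ρₚ≉0 (begin
      ρ p * dots p                                   ≈⟨ +-identityʳ _ ⟨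
      ρ p * dots p + 0#                              ≈⟨ +-congˡ removed≈0 ⟨
      ρ p * dots p + removeAt ρ p · removeAt dots p  ≈⟨ ·-remove ρ dots p ⟨
      ρ · dots                                       ≈⟨ ρdots≈0 ⟩
      0#                                             ∎)
    all-rows : dots ≈ᵛ 0ᵛ
    all-rows k with p Fin.≟ k
    ... | yes ≡.refl = pivot≈0
    ... | no p≢k = trans (reflexive (≡.cong dots (≡.sym (Fin.punchIn-punchOut p≢k))))
                         (proj₂ (proj₂ solution) (punchOut p≢k))

  lincomb-· : ∀ {m n} (γ : Vect m) (v : Fin m → Vect n) i → lincomb γ v i ≈ γ · (λ j → v j i)
  lincomb-· {zero}  γ v i = refl
  lincomb-· {suc m} γ v i = +-congˡ (lincomb-· (γ ∘ suc) (v ∘ suc) i)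

-- Finite fields: the characteristic and the identity x^N = x.

module FiniteField {c ℓ : Level} (K : Field c ℓ) (N : ℕ) (card : HasCard K N) where
  open Field K hiding (zero)
  open FieldOps K
  open Inverse card using (to; from; to-cong; strictlyInverseˡ; strictlyInverseʳ)
  open import Algebra.Properties.Semiring.Mult semiring using () renaming (_×_ to _×ₘ_; ×1-homo-* to ×ₘ1-homo-*)
  open import Algebra.Properties.Semiring.Exp semiring using () renaming (_^_ to _↑_)
  open import Algebra.Properties.Semiring.Sum semiring
    using (sum; sum-cong-≋; sum-permute; sum-replicate; ∑-distrib-+)
  import Algebra.Properties.CommutativeMonoid.Sum *-commutativeMonoid as Product
  open import Algebra.Properties.Group +-group using (identityˡ-unique)
  open import Relation.Binary.Reasoning.Setoid setoid

  _≟_ : Decidable _≈_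
  x ≟ y = map′ to-injective to-cong (to x Fin.≟ to y)
    where
    to-injective : to x ≡ to y → x ≈ y
    to-injective eq = begin
      x           ≈⟨ strictlyInverseʳ x ⟨
      from (to x) ≈⟨ reflexive (≡.cong from eq) ⟩
      from (to y) ≈⟨ strictlyInverseʳ y ⟩
      y           ∎

  open LinearAlgebra K _≟_ using (zero-product; cancel-zero)

  conjugate : (g g⁻¹ : Carrier → Carrier) → (∀ {x y} → x ≈ y → g x ≈ g y) →
              (∀ x → g (g⁻¹ x) ≈ x) → ∀ i → to (g (from (to (g⁻¹ (from i))))) ≡ i
  conjugate g g⁻¹ g-cong gg⁻¹ i = ≡.trans
    (to-cong (trans (g-cong (strictlyInverseʳ _)) (gg⁻¹ (from i)))) (strictlyInverseˡ i)

  -- Transports a bijection of the field to its index set `Fin N`, so that sums and products over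
  -- all elements can be reindexed.
  bijection⇒permutation : (g g⁻¹ : Carrier → Carrier) →
    (∀ {x y} → x ≈ y → g x ≈ g y) → (∀ {x y} → x ≈ y → g⁻¹ x ≈ g⁻¹ y) →
    (∀ x → g (g⁻¹ x) ≈ x) → (∀ x → g⁻¹ (g x) ≈ x) → Permutation N N
  bijection⇒permutation g g⁻¹ g-cong g⁻¹-cong gg⁻¹ g⁻¹g = permutation
    (λ i → to (g (from i))) (λ i → to (g⁻¹ (from i)))
    (conjugate g g⁻¹ g-cong gg⁻¹) (conjugate g⁻¹ g g⁻¹-cong g⁻¹g)

  -- Translation by 1 permutes the field, so the sum S of all elements satisfies N · 1 + S = S.
  cardinality-vanishes : N ×ₘ 1# ≈ 0#
  cardinality-vanishes = identityˡ-unique (N ×ₘ 1#) (sum from) (begin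
    N ×ₘ 1# + sum from                ≈⟨ +-congʳ (sum-replicate N) ⟨
    sum {N} (λ _ → 1#) + sum from     ≈⟨ ∑-distrib-+ {N} (λ _ → 1#) from ⟨
    sum (λ i → 1# + from i)           ≈⟨ sum-cong-≋ (λ i → strictlyInverseʳ (1# + from i)) ⟨
    sum (λ i → from (to (1# + from i))) ≈⟨ sum-permute from shift ⟨
    sum from                          ∎)
    where
    shift = bijection⇒permutation (1# +_) (- 1# +_) +-congˡ +-congˡ
      (λ x → trans (sym (+-assoc _ _ _)) (trans (+-congʳ (-‿inverseʳ 1#)) (+-identityˡ x)))
      (λ x → trans (sym (+-assoc _ _ _)) (trans (+-congʳ (-‿inverseˡ 1#)) (+-identityˡ x)))

  -- A field has no zero divisors, so one of the factors 2 must vanish; the empty product cannot,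
  -- since 0 and 1 differ.
  power-of-two-vanishes : ∀ m → (2 ℕ.^ m) ×ₘ 1# ≈ 0# → 1# + 1# ≈ 0#
  power-of-two-vanishes zero    eq = contradiction (trans (sym eq) (+-identityʳ 1#)) 0≉1
  power-of-two-vanishes (suc m) eq with zero-product _ _ (trans (sym (×ₘ1-homo-* 2 (2 ℕ.^ m))) eq)
  ... | inj₁ 2≈0 = trans (+-congˡ (sym (+-identityʳ 1#))) 2≈0
  ... | inj₂ eq′ = power-of-two-vanishes m eq′

  product-single : ∀ {n x} (p : Fin n) (f : Vect n) → f p ≈ x → (∀ j → j ≢ p → f j ≈ 1#) →
                   Product.sum f ≈ x
  product-single {suc n} {x} p f fp≈x f≈1 = begin
    Product.sum f                           ≈⟨ Product.sum-remove {i = p} f ⟩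
    f p * Product.sum (removeAt f p)        ≈⟨ *-cong fp≈x (Product.sum-cong-≋ (λ j → f≈1 _ (Fin.punchInᵢ≢i p j))) ⟩
    x * Product.sum {n} (λ _ → 1#)          ≈⟨ *-congˡ (Product.sum-replicate-zero n) ⟩
    x * 1#                                  ≈⟨ *-identityʳ x ⟩
    x                                       ∎

  product-nonzero : ∀ {n} (f : Vect n) → (∀ j → ¬ (f j ≈ 0#)) → ¬ (Product.sum f ≈ 0#)
  product-nonzero {zero}  f f≉0 eq = 0≉1 (sym eq)
  product-nonzero {suc n} f f≉0 eq =
    product-nonzero (f ∘ suc) (f≉0 ∘ suc) (cancel-zero (f≉0 zero) eq)

  pow≡↑ : ∀ x n → pow x n ≡ x ↑ n
  pow≡↑ x zero    = ≡.refl
  pow≡↑ x (suc n) = ≡.cong (x *_) (pow≡↑ x n)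

  -- Replacing 0 by 1 lets the product of the nonzero elements run over all indices in `Fin N`.
  unit-part : Carrier → Carrier
  unit-part y with y ≟ 0#
  ... | yes _ = 1#
  ... | no  _ = y

  unit-part-nonzero : ∀ y → ¬ (unit-part y ≈ 0#)
  unit-part-nonzero y with y ≟ 0#
  ... | yes _   = λ eq → 0≉1 (sym eq)
  ... | no  y≉0 = y≉0

  unit-part-cong : ∀ {x y} → x ≈ y → unit-part x ≈ unit-part y
  unit-part-cong {x} {y} x≈y with x ≟ 0# | y ≟ 0#
  ... | yes _   | yes _   = refl
  ... | yes x≈0 | no y≉0  = contradiction (trans (sym x≈y) x≈0) y≉0
  ... | no x≉0  | yes y≈0 = contradiction (trans x≈y y≈0) x≉0
  ... | no _    | no _    = x≈y

  at-zero : Carrier → Carrier → Carrier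
  at-zero x y with y ≟ 0#
  ... | yes _ = x
  ... | no  _ = 1#

  at-zero-zero : ∀ x {y} → y ≈ 0# → at-zero x y ≈ x
  at-zero-zero x {y} y≈0 with y ≟ 0#
  ... | yes _   = refl
  ... | no  y≉0 = contradiction y≈0 y≉0

  at-zero-nonzero : ∀ x {y} → ¬ (y ≈ 0#) → at-zero x y ≈ 1#
  at-zero-nonzero x {y} y≉0 with y ≟ 0#
  ... | yes y≈0 = contradiction y≈0 y≉0
  ... | no  _   = refl

  -- At y = 0 the left `unit-part` is 1 while the right side is x; `at-zero` supplies exactly that
  -- missing factor.
  unit-part-* : ∀ {x} y → ¬ (x ≈ 0#) → at-zero x y * unit-part (x * y) ≈ x * unit-part y
  unit-part-* {x} y x≉0 with y ≟ 0# | (x * y) ≟ 0#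
  ... | yes _   | yes _    = refl
  ... | yes y≈0 | no xy≉0  = contradiction (trans (*-congˡ y≈0) (zeroʳ x)) xy≉0
  ... | no y≉0  | yes xy≈0 = contradiction (cancel-zero x≉0 xy≈0) y≉0
  ... | no _    | no _     = *-identityˡ (x * y)

  cancelʳ : ∀ {x y z} → ¬ (z ≈ 0#) → x * z ≈ y * z → x ≈ y
  cancelʳ {x} {y} {z} z≉0 eq = begin
    x              ≈⟨ *-identityʳ x ⟨
    x * 1#         ≈⟨ *-congˡ zz⁻¹≈1 ⟨
    x * (z * z⁻¹)  ≈⟨ *-assoc x z z⁻¹ ⟨
    x * z * z⁻¹    ≈⟨ *-congʳ eq ⟩
    y * z * z⁻¹    ≈⟨ *-assoc y z z⁻¹ ⟩
    y * (z * z⁻¹)  ≈⟨ *-congˡ zz⁻¹≈1 ⟩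
    y * 1#         ≈⟨ *-identityʳ y ⟩
    y              ∎
    where
    z⁻¹ = proj₁ (inverse z z≉0)
    zz⁻¹≈1 = proj₂ (inverse z z≉0)

  -- The argument of type `Fin n` witnesses that the exponent is positive; the power with exponent 0
  -- would be 1.
  pow-zero : ∀ {x n} → Fin n → x ≈ 0# → pow x n ≈ 0#
  pow-zero {n = suc n} _ x≈0 = trans (*-congʳ x≈0) (zeroˡ _)

  -- Multiplication by x permutes K, so it preserves the product P of the nonzero
  -- elements; the factor at 0 is x, which gives x^N P = x P without subtracting 1 from N.
  pow-card : ∀ x → pow x N ≈ x
  pow-card x with x ≟ 0#
  ... | yes x≈0 = trans (pow-zero (to 0#) x≈0) (sym x≈0)
  ... | no x≉0 = cancelʳ P≉0 (begin
    pow x N * P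
      ≈⟨ *-congʳ (trans (reflexive (pow≡↑ x N)) (sym (Product.sum-replicate N))) ⟩
    Product.sum {N} (λ _ → x) * P
      ≈⟨ Product.∑-distrib-+ {N} (λ _ → x) (unit-part ∘ from) ⟨
    Product.sum (λ i → x * unit-part (from i))
      ≈⟨ Product.sum-cong-≋ (λ i → unit-part-* (from i) x≉0) ⟨
    Product.sum (λ i → at-zero x (from i) * unit-part (x * from i))
      ≈⟨ Product.∑-distrib-+ (at-zero x ∘ from) (λ i → unit-part (x * from i)) ⟩
    Product.sum (at-zero x ∘ from) * Product.sum (λ i → unit-part (x * from i))
      ≈⟨ *-cong (product-single (to 0#) (at-zero x ∘ from) (at-zero-zero x (strictlyInverseʳ 0#)) away)
                (Product.sum-cong-≋ (λ i → unit-part-cong (sym (strictlyInverseʳ (x * from i))))) ⟩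
    x * Product.sum (λ i → unit-part (from (to (x * from i))))
      ≈⟨ *-congˡ (Product.sum-permute (unit-part ∘ from) scaling) ⟨
    x * P ∎)
    where
    P = Product.sum (unit-part ∘ from)
    P≉0 = product-nonzero (unit-part ∘ from) (λ i → unit-part-nonzero (from i))
    x⁻¹ = proj₁ (inverse x x≉0)
    xx⁻¹≈1 = proj₂ (inverse x x≉0)
    scaling = bijection⇒permutation (x *_) (x⁻¹ *_) *-congˡ *-congˡ
      (λ y → trans (sym (*-assoc _ _ _)) (trans (*-congʳ xx⁻¹≈1) (*-identityˡ y)))
      (λ y → trans (sym (*-assoc _ _ _)) (trans (*-congʳ (trans (*-comm _ _) xx⁻¹≈1)) (*-identityˡ y)))
    away : ∀ j → j ≢ to 0# → at-zero x (from j) ≈ 1#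
    away j j≢ = at-zero-nonzero x λ eq → j≢ (≡.trans (≡.sym (strictlyInverseˡ j)) (to-cong eq))

-- Polynomial identities in characteristic two.

module CharacteristicTwo {c ℓ : Level} (K : Field c ℓ) (1+1≈0 : Field._≈_ K (Field._+_ K (Field.1# K) (Field.1# K)) (Field.0# K)) where
  open Field K hiding (zero)
  open import Algebra.Properties.Group +-group using (inverseˡ-unique)
  open import Algebra.Solver.Ring.AlmostCommutativeRing
    using (AlmostCommutativeRing; fromCommutativeRing; _-Raw-AlmostCommutative⟶_)

  -- The ring solver takes its coefficients in 𝔽₂, realised as the Booleans under xor and ∧, so that
  -- its normal forms cancel 1 + 1.
  coefficients : RawRing _ _
  coefficients = CommutativeRing.rawRing xor-∧-commutativeRing

  ⟦_⟧₂ : Bool → Carrier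
  ⟦ false ⟧₂ = 0#
  ⟦ true  ⟧₂ = 1#

  -‿fixes : ∀ b → ⟦ b ⟧₂ ≈ - ⟦ b ⟧₂
  -‿fixes false = inverseˡ-unique 0# 0# (+-identityˡ 0#)
  -‿fixes true  = inverseˡ-unique 1# 1# 1+1≈0

  𝔽₂-embedding : coefficients -Raw-AlmostCommutative⟶ fromCommutativeRing commutativeRing
  𝔽₂-embedding = record
    { ⟦_⟧    = ⟦_⟧₂
    ; +-homo = λ
      { false b     → sym (+-identityˡ ⟦ b ⟧₂)
      ; true  false → sym (+-identityʳ 1#)
      ; true  true  → sym 1+1≈0 }
    ; *-homo = λ
      { false b → sym (zeroˡ ⟦ b ⟧₂)
      ; true  b → sym (*-identityˡ ⟦ b ⟧₂) }
    ; -‿homo = -‿fixes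
    ; 0-homo = refl
    ; 1-homo = refl
    }

  coefficient-equality : (a b : Bool) → Maybe (⟦ a ⟧₂ ≈ ⟦ b ⟧₂)
  coefficient-equality a b with a Bool.≟ b
  ... | yes a≡b = just (reflexive (≡.cong ⟦_⟧₂ a≡b))
  ... | no  _   = nothing

  open import Algebra.Solver.Ring coefficients (fromCommutativeRing commutativeRing)
    𝔽₂-embedding coefficient-equality public
    using (solve; _:=_; _:+_; _:*_; con)

  x+x≈0 : ∀ x → x + x ≈ 0#
  x+x≈0 = solve 1 (λ x → x :+ x := con false) refl

  x≈y⇒x+y≈0 : ∀ {x y} → x ≈ y → x + y ≈ 0#
  x≈y⇒x+y≈0 x≈y = trans (+-congʳ x≈y) (x+x≈0 _)

  x+y≈0⇒x≈y : ∀ {x y} → x + y ≈ 0# → x ≈ y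
  x+y≈0⇒x≈y {x} {y} eq = trans
    (solve 2 (λ x y → x := (x :+ y) :+ y) refl x y) (trans (+-congʳ eq) (+-identityˡ y))

-- The q-Frobenius of 𝔽_{q⁴}, Galois descent and Frobenius recurrences.

module Frobenius {c ℓ : Level} (K : Field c ℓ) (k : ℕ)
  (card : HasCard K ((2 ℕ.^ suc (2 ℕ.* k)) ℕ.^ 4)) where
  open Field K hiding (zero)
  open FieldOps K
  open import Algebra.Properties.Semiring.Exp semiring using (^-congˡ; ^-assocʳ)
  open import Algebra.Properties.CommutativeSemiring.Exp commutativeSemiring using (^-distrib-*)
  open import Relation.Binary.Reasoning.Setoid setoid

  q : ℕ
  q = 2 ℕ.^ suc (2 ℕ.* k)

  open FiniteField K (q ℕ.^ 4) card public
    using (_≟_; pow≡↑; pow-card; cardinality-vanishes; power-of-two-vanishes)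
  open import Algebra.Properties.Semiring.Mult semiring using () renaming (_×_ to _×ₘ_)

  1+1≈0 : 1# + 1# ≈ 0#
  1+1≈0 = power-of-two-vanishes (suc (2 ℕ.* k) ℕ.* 4)
    (trans (reflexive (≡.cong (_×ₘ 1#) (≡.sym (ℕ.^-*-assoc 2 (suc (2 ℕ.* k)) 4)))) cardinality-vanishes)

  open CharacteristicTwo K 1+1≈0 public
  open LinearAlgebra K _≟_ public

  pow-cong : ∀ n {x y} → x ≈ y → pow x n ≈ pow y n
  pow-cong n {x} {y} x≈y rewrite pow≡↑ x n | pow≡↑ y n = ^-congˡ n x≈y

  pow-pow : ∀ x m n → pow (pow x m) n ≈ pow x (m ℕ.* n)
  pow-pow x m n rewrite pow≡↑ (pow x m) n | pow≡↑ x m | pow≡↑ x (m ℕ.* n) = ^-assocʳ x m n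

  pow-* : ∀ n x y → pow (x * y) n ≈ pow x n * pow y n
  pow-* n x y rewrite pow≡↑ (x * y) n | pow≡↑ x n | pow≡↑ y n = ^-distrib-* x y n

  -- Squaring is additive because the cross term 2xy vanishes; this is iterated `m` times.
  pow-2^-+ : ∀ m x y → pow (x + y) (2 ℕ.^ m) ≈ pow x (2 ℕ.^ m) + pow y (2 ℕ.^ m)
  pow-2^-+ zero    x y = solve 2 (λ x y → (x :+ y) :* con true := x :* con true :+ y :* con true) refl x y
  pow-2^-+ (suc m) x y = begin
    pow (x + y) (2 ℕ.* 2 ℕ.^ m)        ≈⟨ pow-pow (x + y) 2 (2 ℕ.^ m) ⟨
    pow (pow (x + y) 2) (2 ℕ.^ m)      ≈⟨ pow-cong (2 ℕ.^ m) (solve 2 (λ x y →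
      (x :+ y) :* ((x :+ y) :* con true) := x :* (x :* con true) :+ y :* (y :* con true)) refl x y) ⟩
    pow (pow x 2 + pow y 2) (2 ℕ.^ m)  ≈⟨ pow-2^-+ m (pow x 2) (pow y 2) ⟩
    pow (pow x 2) (2 ℕ.^ m) + pow (pow y 2) (2 ℕ.^ m) ≈⟨ +-cong (pow-pow x 2 (2 ℕ.^ m)) (pow-pow y 2 (2 ℕ.^ m)) ⟩
    pow x (2 ℕ.* 2 ℕ.^ m) + pow y (2 ℕ.* 2 ℕ.^ m) ∎

  pow-1 : ∀ n → pow 1# n ≈ 1#
  pow-1 zero    = refl
  pow-1 (suc n) = trans (*-identityˡ _) (pow-1 n)

  -- Iterating, instead of taking the power q^i at once, makes `frob 1 (frob i x)` and
  -- `frob (suc i) x` equal by computation.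
  frob : ℕ → Carrier → Carrier
  frob zero    x = x
  frob (suc i) x = pow (frob i x) q

  frob-cong : ∀ i {x y} → x ≈ y → frob i x ≈ frob i y
  frob-cong zero    x≈y = x≈y
  frob-cong (suc i) x≈y = pow-cong q (frob-cong i x≈y)

  frob-+ : ∀ i x y → frob i (x + y) ≈ frob i x + frob i y
  frob-+ zero    x y = refl
  frob-+ (suc i) x y = trans (pow-cong q (frob-+ i x y)) (pow-2^-+ (suc (2 ℕ.* k)) _ _)

  frob-* : ∀ i x y → frob i (x * y) ≈ frob i x * frob i y
  frob-* zero    x y = refl
  frob-* (suc i) x y = trans (pow-cong q (frob-* i x y)) (pow-* q _ _)

  frob-1 : ∀ i → frob i 1# ≈ 1#
  frob-1 zero    = refl
  frob-1 (suc i) = trans (pow-cong q (frob-1 i)) (pow-1 q)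

  frob-0 : ∀ i → frob i 0# ≈ 0#
  frob-0 i = trans (trans (frob-cong i (sym 1+1≈0)) (frob-+ i 1# 1#)) (x+x≈0 _)

  frob-frob : ∀ i j x → frob i (frob j x) ≡ frob (i ℕ.+ j) x
  frob-frob zero    j x = ≡.refl
  frob-frob (suc i) j x = ≡.cong (λ z → pow z q) (frob-frob i j x)

  frob-suc : ∀ i x → frob i (frob 1 x) ≡ frob (suc i) x
  frob-suc i x = ≡.trans (frob-frob i 1 x) (≡.cong (λ n → frob n x) (ℕ.+-comm i 1))

  frob≈pow : ∀ i x → frob i x ≈ pow x (q ℕ.^ i)
  frob≈pow zero    x = sym (*-identityʳ x)
  frob≈pow (suc i) x = begin
    pow (frob i x) q          ≈⟨ pow-cong q (frob≈pow i x) ⟩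
    pow (pow x (q ℕ.^ i)) q   ≈⟨ pow-pow x (q ℕ.^ i) q ⟩
    pow x (q ℕ.^ i ℕ.* q)     ≈⟨ reflexive (≡.cong (pow x) (ℕ.*-comm (q ℕ.^ i) q)) ⟩
    pow x (q ℕ.^ suc i)       ∎

  frob-period : ∀ x → frob 4 x ≈ x
  frob-period x = trans (frob≈pow 4 x) (pow-card x)

  -- The third iterate inverts the Frobenius, since the fourth is the identity.
  frob-injective : ∀ {x y} → frob 1 x ≈ frob 1 y → x ≈ y
  frob-injective {x} {y} eq = begin
    x                  ≈⟨ frob-period x ⟨
    frob 4 x           ≈⟨ frob-cong 3 eq ⟩
    frob 4 y           ≈⟨ frob-period y ⟩
    y                  ∎

  frob-· : ∀ {n} i (α x : Vect n) → frob i (α · x) ≈ (frob i ∘ α) · (frob i ∘ x)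
  frob-· {zero}  i α x = frob-0 i
  frob-· {suc n} i α x = trans (frob-+ i _ _) (+-cong (frob-* i _ _) (frob-· i (α ∘ suc) (x ∘ suc)))

  frob-·-fixed : ∀ {n} i (γ x : Vect n) → (∀ j → InFq q (γ j)) → γ · x ≈ 0# → γ · (frob i ∘ x) ≈ 0#
  frob-·-fixed i γ x γ∈Fq γx≈0 = begin
    γ · (frob i ∘ x)             ≈⟨ ·-cong (λ j → sym (fixed i j)) (λ _ → refl) ⟩
    (frob i ∘ γ) · (frob i ∘ x)  ≈⟨ frob-· i γ x ⟨
    frob i (γ · x)               ≈⟨ frob-cong i γx≈0 ⟩
    frob i 0#                    ≈⟨ frob-0 i ⟩
    0#                           ∎
    where
    fixed : ∀ i j → frob i (γ j) ≈ γ j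
    fixed zero    j = refl
    fixed (suc i) j = trans (pow-cong q (fixed i j)) (γ∈Fq j)

  -- The family is stored by coordinates: `x l j` is coordinate `l` of point `j`, and `γ` is a
  -- relation among the n points.
  FqDependent : ∀ {m n} → (Fin m → Vect n) → Set _
  FqDependent x = ∃[ γ ] ((∀ j → InFq q (γ j)) × Nontrivial γ × (∀ l → γ · x l ≈ 0#))

  -- Galois descent: normalise one coefficient of the relation to 1 and add its Frobenius
  -- conjugate, which is again a relation; this shortens it unless it is already over 𝔽_q.
  mutual
    descent : ∀ {m n} (x : Fin m → Vect n) (α : Vect n) → Nontrivial α →
              (∀ i l → α · (frob i ∘ x l) ≈ 0#) → FqDependent x
    descent x α (p , αₚ≉0) αx≈0 = monic-descent x (a ·ᵛ α) p
      (trans (*-comm a (α p)) (proj₂ (inverse (α p) αₚ≉0)))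
      (λ i l → ·-scale-zeroˡ α (frob i ∘ x l) a (αx≈0 i l))
      where a = proj₁ (inverse (α p) αₚ≉0)

    monic-descent : ∀ {m n} (x : Fin m → Vect n) (β : Vect n) p → β p ≈ 1# →
                    (∀ i l → β · (frob i ∘ x l) ≈ 0#) → FqDependent x
    monic-descent {n = suc n} x β p βₚ≈1 βx≈0 = conclude (zero-or-nontrivial δ)
      where
      δ : Vect (suc n)
      δ = (frob 1 ∘ β) +ᵛ β
      δₚ≈0 : δ p ≈ 0#
      δₚ≈0 = x≈y⇒x+y≈0 (trans (frob-cong 1 βₚ≈1) (trans (frob-1 1) (sym βₚ≈1)))
      conjugate-relation : ∀ i l → (frob 1 ∘ β) · (frob (suc i) ∘ x l) ≈ 0#
      conjugate-relation i l = trans (sym (frob-· 1 β (frob i ∘ x l)))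
        (trans (frob-cong 1 (βx≈0 i l)) (frob-0 1))
      δx≈0-suc : ∀ i l → δ · (frob (suc i) ∘ x l) ≈ 0#
      δx≈0-suc i l = ·-sum-zeroˡ (frob 1 ∘ β) β (frob (suc i) ∘ x l)
        (conjugate-relation i l) (βx≈0 (suc i) l)
      δx≈0 : ∀ i l → δ · (frob i ∘ x l) ≈ 0#
      -- Conjugating a relation raises the Frobenius index, so index 0 is only reached by going
      -- round the cycle: it is index 4.
      δx≈0 zero    l = trans (·-congˡ {α = δ} (λ j → sym (frob-period (x l j)))) (δx≈0-suc 3 l)
      δx≈0 (suc i) l = δx≈0-suc i l
      drop : ∀ i l → δ · (frob i ∘ x l) ≈ removeAt δ p · (frob i ∘ removeAt (x l) p)
      drop i l = trans (·-remove δ (frob i ∘ x l) p)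
        (trans (+-congʳ (trans (*-congʳ δₚ≈0) (zeroˡ _))) (+-identityˡ _))
      in-Fq : (γ : Vect n) → (∀ j → InFq q (γ j)) → ∀ j → InFq q (insertAt γ p 0# j)
      in-Fq γ γ∈Fq j with p Fin.≟ j
      ... | yes ≡.refl rewrite insertAt-lookup γ p 0# = frob-0 1
      ... | no p≢j rewrite ≡.sym (Fin.punchIn-punchOut p≢j) | insertAt-punchIn γ p 0# (punchOut p≢j) =
        γ∈Fq (punchOut p≢j)
      conclude : δ ≈ᵛ 0ᵛ ⊎ Nontrivial δ → FqDependent x
      conclude (inj₁ δ≈0) =
        β , (λ j → x+y≈0⇒x≈y (δ≈0 j)) , (p , λ βₚ≈0 → 0≉1 (trans (sym βₚ≈0) βₚ≈1)) , βx≈0 0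
      conclude (inj₂ δ≉0) =
        -- The coefficient of `δ` at `p` is 0, so point `p` is dropped and the recursion runs on one
        -- point fewer; `γ` is then extended by 0 at `p`.
        let γ , γ∈Fq , γ≉0 , γx≈0 = descent (λ l → removeAt (x l) p) (removeAt δ p)
              (removeAt-nontrivial {α = δ} p δₚ≈0 δ≉0) (λ i l → trans (sym (drop i l)) (δx≈0 i l))
        in insertAt γ p 0# , in-Fq γ γ∈Fq , insertAt-nontrivial {α = γ} p 0# γ≉0 ,
           λ l → trans (·-insertAt-0 γ (x l) p) (γx≈0 l)

  -- The coefficients `A`, `B` do not depend on the point `j`. The i-th conjugate of the recurrence
  -- therefore writes the vectors of index i + 2 as K-combinations of those of index i and i + 1,
  -- all of which `α` kills.
  recurrence-propagates-relation : ∀ {m n} (x : Fin m → Vect n) (A B : Fin m → Vect m) →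
    (∀ l j → frob 2 (x l j) ≈ A l · (λ r → x r j) + B l · (λ r → frob 1 (x r j))) →
    ∀ α → (∀ l → α · x l ≈ 0#) → (∀ l → α · (frob 1 ∘ x l) ≈ 0#) →
    ∀ i l → α · (frob i ∘ x l) ≈ 0#
  recurrence-propagates-relation x A B rec α αx≈0 αx₁≈0 zero = αx≈0
  recurrence-propagates-relation x A B rec α αx≈0 αx₁≈0 (suc zero) = αx₁≈0
  recurrence-propagates-relation x A B rec α αx≈0 αx₁≈0 (suc (suc i)) l = begin
    α · (frob (suc (suc i)) ∘ x l)
      ≈⟨ ·-congˡ {α = α} step ⟩
    α · ((λ j → Aᵢ · (λ r → frob i (x r j))) +ᵛ (λ j → Bᵢ · (λ r → frob (suc i) (x r j))))
      ≈⟨ ·-sum-zeroʳ α _ _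
           (combination {w = λ r → frob i ∘ x r} Aᵢ (recurrence-propagates-relation x A B rec α αx≈0 αx₁≈0 i))
           (combination {w = λ r → frob (suc i) ∘ x r} Bᵢ (recurrence-propagates-relation x A B rec α αx≈0 αx₁≈0 (suc i))) ⟩
    0# ∎
    where
    Aᵢ = frob i ∘ A l
    Bᵢ = frob i ∘ B l
    combination : ∀ {w : _ → Vect _} ρ → (∀ r → α · w r ≈ 0#) → α · (λ j → ρ · (λ r → w r j)) ≈ 0#
    combination {w} ρ αw≈0 = trans (sym (·-exchange ρ α w)) (·-zeroʳ ρ αw≈0)
    step : ∀ j → frob (suc (suc i)) (x l j) ≈
                 Aᵢ · (λ r → frob i (x r j)) + Bᵢ · (λ r → frob (suc i) (x r j))
    step j = begin
      frob (suc (suc i)) (x l j)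
        ≡⟨ ≡.trans (frob-frob i 2 (x l j)) (≡.cong (λ n → frob n (x l j)) (ℕ.+-comm i 2)) ⟨
      frob i (frob 2 (x l j))
        ≈⟨ frob-cong i (rec l j) ⟩
      frob i (A l · (λ r → x r j) + B l · (λ r → frob 1 (x r j)))
        ≈⟨ frob-+ i _ _ ⟩
      frob i (A l · (λ r → x r j)) + frob i (B l · (λ r → frob 1 (x r j)))
        ≈⟨ +-cong (frob-· i (A l) _) (trans (frob-· i (B l) _)
             (·-congˡ {α = Bᵢ} (λ r → reflexive (frob-suc i (x r j))))) ⟩
      Aᵢ · (λ r → frob i (x r j)) + Bᵢ · (λ r → frob (suc i) (x r j)) ∎

-- Evasiveness of U, beginning with the elements excluded for q an odd power of two.

module Evasiveness {c ℓ : Level} (K : Field c ℓ) (k : ℕ)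
  (card : HasCard K ((2 ℕ.^ suc (2 ℕ.* k)) ℕ.^ 4)) where
  open Field K hiding (zero)
  open FieldOps K
  open Frobenius K k card
  open import Relation.Binary.Reasoning.Setoid setoid

  absorb : ∀ {x p} → p ≈ 0# → x + p ≈ x
  absorb p≈0 = trans (+-congˡ p≈0) (+-identityʳ _)

  frob-zero : ∀ {x} → frob 1 x ≈ 0# → x ≈ 0#
  frob-zero eq = frob-injective (trans eq (sym (frob-0 1)))

  frob-+1 : ∀ x → frob 1 (x + 1#) ≈ frob 1 x + 1#
  frob-+1 x = trans (frob-+ 1 x 1#) (+-congˡ (frob-1 1))

  t≉t+1 : ∀ {t} → ¬ (t ≈ t + 1#)
  t≉t+1 {t} eq = 0≉1 (begin
    0#            ≈⟨ x≈y⇒x+y≈0 eq ⟨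
    t + (t + 1#)  ≈⟨ solve 1 (λ t → t :+ (t :+ con true) := con true) refl t ⟩
    1#            ∎)

  -- The oddness of the exponent enters here: q = 2 · 4ᵏ.
  pow-q : ∀ t → frob 1 t ≈ pow t (4 ℕ.^ k) * pow t (4 ℕ.^ k)
  pow-q t = begin
    pow t (2 ℕ.* 2 ℕ.^ (2 ℕ.* k))    ≡⟨ ≡.cong (pow t) (ℕ.*-comm 2 (2 ℕ.^ (2 ℕ.* k))) ⟩
    pow t (2 ℕ.^ (2 ℕ.* k) ℕ.* 2)    ≈⟨ pow-pow t (2 ℕ.^ (2 ℕ.* k)) 2 ⟨
    pow (pow t (2 ℕ.^ (2 ℕ.* k))) 2  ≈⟨ *-congˡ (*-identityʳ _) ⟩
    pow t (2 ℕ.^ (2 ℕ.* k)) * pow t (2 ℕ.^ (2 ℕ.* k))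
      ≡⟨ ≡.cong (λ n → pow t n * pow t n) (ℕ.^-*-assoc 2 2 k) ⟨
    pow t (4 ℕ.^ k) * pow t (4 ℕ.^ k) ∎

  pow-4 : ∀ t → pow t 4 ≈ (t * t) * (t * t)
  pow-4 = solve 1 (λ t → t :* (t :* (t :* (t :* con true))) := (t :* t) :* (t :* t)) refl

  pow-4^-step : ∀ t {s} m → (t * t) * (t * t) ≈ s → pow t (4 ℕ.^ suc m) ≈ pow s (4 ℕ.^ m)
  pow-4^-step t m t⁴≈s =
    trans (sym (pow-pow t 4 (4 ℕ.^ m))) (pow-cong (4 ℕ.^ m) (trans (pow-4 t) t⁴≈s))

  pow-4^-fixed : ∀ t m → (t * t) * (t * t) ≈ t → pow t (4 ℕ.^ m) ≈ t
  pow-4^-fixed t zero    t⁴≈t = *-identityʳ t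
  pow-4^-fixed t (suc m) t⁴≈t = trans (pow-4^-step t m t⁴≈t) (pow-4^-fixed t m t⁴≈t)

  -- Since (t + 1)⁴ = t⁴ + 1 = (t + 1) + 1, the hypothesis passes from t to t + 1, and repeated
  -- fourth powers alternate between the two.
  pow-4^-shifted : ∀ t m → (t * t) * (t * t) ≈ t + 1# →
                   pow t (4 ℕ.^ m) ≈ t ⊎ pow t (4 ℕ.^ m) ≈ t + 1#
  pow-4^-shifted t zero    t⁴≈t+1 = inj₁ (*-identityʳ t)
  pow-4^-shifted t (suc m) t⁴≈t+1 with pow-4^-shifted (t + 1#) m (begin
      ((t + 1#) * (t + 1#)) * ((t + 1#) * (t + 1#))
        ≈⟨ solve 1 (λ t → ((t :+ con true) :* (t :+ con true)) :* ((t :+ con true) :* (t :+ con true))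
                          := (t :* t) :* (t :* t) :+ con true) refl t ⟩
      (t * t) * (t * t) + 1#  ≈⟨ +-congʳ t⁴≈t+1 ⟩
      t + 1# + 1#             ∎)
  ... | inj₁ eq = inj₂ (trans (pow-4^-step t m t⁴≈t+1) eq)
  ... | inj₂ eq = inj₁ (trans (pow-4^-step t m t⁴≈t+1)
    (trans eq (solve 1 (λ t → t :+ con true :+ con true := t) refl t)))

  -- A root of t² = t + b lies in 𝔽₂ for b = 0 and in 𝔽₄ for b = 1; in both cases t⁴ = t.
  F₂-or-F₄-fixed : ∀ {t} b → t * t ≈ t + ⟦ b ⟧₂ → (t * t) * (t * t) ≈ t
  F₂-or-F₄-fixed {t} false eq = begin
    (t * t) * (t * t)  ≈⟨ *-cong t²≈t t²≈t ⟩
    t * t              ≈⟨ t²≈t ⟩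
    t                  ∎
    where t²≈t = trans eq (+-identityʳ t)
  F₂-or-F₄-fixed {t} true eq = begin
    (t * t) * (t * t)      ≈⟨ *-cong eq eq ⟩
    (t + 1#) * (t + 1#)    ≈⟨ solve 1 (λ t → (t :+ con true) :* (t :+ con true) := t :* t :+ con true) refl t ⟩
    t * t + 1#             ≈⟨ +-congʳ eq ⟩
    t + 1# + 1#            ≈⟨ solve 1 (λ t → t :+ con true :+ con true := t) refl t ⟩
    t                      ∎

  -- Raising to the power 4ᵏ fixes 𝔽₄, so the power q = 2 · 4ᵏ acts on it as squaring.
  F₄-conjugation : ∀ t → t * t ≈ t + 1# → frob 1 t ≈ t + 1#
  F₄-conjugation t t²≈t+1 = trans (pow-q t) (trans (*-cong fixed fixed) t²≈t+1)
    where
    fixed : pow t (4 ℕ.^ k) ≈ t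
    fixed = pow-4^-fixed t k (F₂-or-F₄-fixed true t²≈t+1)

  -- As q = 2 · 4ᵏ, t⁴ = t + 1 gives t^q ∈ {t², t² + 1}, so t^q = t + 1 puts t in 𝔽₄.
  frob-shift-contradiction : ∀ t → (t * t) * (t * t) ≈ t + 1# → ¬ (frob 1 t ≈ t + 1#)
  frob-shift-contradiction t t⁴≈t+1 t₁≈t+1 with pow-4^-shifted t k t⁴≈t+1
  ... | inj₁ eq = t≉t+1 (trans (sym (F₂-or-F₄-fixed true (begin
    t * t                               ≈⟨ *-cong eq eq ⟨
    pow t (4 ℕ.^ k) * pow t (4 ℕ.^ k)   ≈⟨ pow-q t ⟨
    frob 1 t                            ≈⟨ t₁≈t+1 ⟩
    t + 1#                              ∎))) t⁴≈t+1)
  ... | inj₂ eq = t≉t+1 (trans (sym (F₂-or-F₄-fixed false (begin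
    t * t                               ≈⟨ solve 1 (λ t → t :* t := (t :+ con true) :* (t :+ con true) :+ con true) refl t ⟩
    (t + 1#) * (t + 1#) + 1#            ≈⟨ +-congʳ (*-cong eq eq) ⟨
    pow t (4 ℕ.^ k) * pow t (4 ℕ.^ k) + 1# ≈⟨ +-congʳ (pow-q t) ⟨
    frob 1 t + 1#                       ≈⟨ +-congʳ t₁≈t+1 ⟩
    t + 1# + 1#                         ≈⟨ +-assoc t 1# 1# ⟩
    t + (1# + 1#)                       ≈⟨ +-congˡ 1+1≈0 ⟩
    t + 0#                              ∎))) t⁴≈t+1)

  -- The equation says t^q = 1 + 1/t, and the map t ↦ 1 + 1/t has order 3 in characteristic two. So
  -- t^(q³) = t, and with t^(q⁴) = t this gives t^q = t. Then t² = t + 1, where `F₄-conjugation`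
  -- demands t^q = t + 1 instead.
  frob-mul-contradiction : ∀ t → ¬ (t * frob 1 t ≈ t + 1#)
  frob-mul-contradiction t tt₁≈t+1 = t≉t+1 (trans (sym t₁≈t) (F₄-conjugation t (begin
    t * t          ≈⟨ *-congˡ t₁≈t ⟨
    t * frob 1 t   ≈⟨ tt₁≈t+1 ⟩
    t + 1#         ∎)))
    where
    twist : ∀ {x} → x * frob 1 x ≈ x + 1# → frob 1 x * frob 2 x ≈ frob 1 x + 1#
    twist {x} eq = trans (sym (frob-* 1 x (frob 1 x))) (trans (frob-cong 1 eq) (frob-+1 x))
    t₁t₂≈t₁+1 = twist tt₁≈t+1
    t₂t₃≈t₂+1 = twist t₁t₂≈t₁+1
    [t+1]t₂≈1 : (t + 1#) * frob 2 t ≈ 1#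
    [t+1]t₂≈1 = begin
      (t + 1#) * frob 2 t        ≈⟨ *-congʳ tt₁≈t+1 ⟨
      t * frob 1 t * frob 2 t    ≈⟨ *-assoc _ _ _ ⟩
      t * (frob 1 t * frob 2 t)  ≈⟨ *-congˡ t₁t₂≈t₁+1 ⟩
      t * (frob 1 t + 1#)        ≈⟨ distribˡ _ _ _ ⟩
      t * frob 1 t + t * 1#      ≈⟨ +-cong tt₁≈t+1 (*-identityʳ t) ⟩
      t + 1# + t                 ≈⟨ solve 1 (λ t → t :+ con true :+ t := con true) refl t ⟩
      1#                         ∎
    t₃≈t : frob 3 t ≈ t
    t₃≈t = begin
      frob 3 t                            ≈⟨ *-identityˡ _ ⟨
      1# * frob 3 t                       ≈⟨ *-congʳ [t+1]t₂≈1 ⟨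
      (t + 1#) * frob 2 t * frob 3 t      ≈⟨ *-assoc _ _ _ ⟩
      (t + 1#) * (frob 2 t * frob 3 t)    ≈⟨ *-congˡ t₂t₃≈t₂+1 ⟩
      (t + 1#) * (frob 2 t + 1#)          ≈⟨ trans (distribˡ _ _ _) (+-cong [t+1]t₂≈1 (*-identityʳ _)) ⟩
      1# + (t + 1#)                       ≈⟨ solve 1 (λ t → con true :+ (t :+ con true) := t) refl t ⟩
      t                                   ∎
    t₁≈t : frob 1 t ≈ t
    t₁≈t = trans (frob-cong 1 (sym t₃≈t)) (frob-period t)

  -- Planes meeting x = y = 0 nontrivially.

  -- For v ≠ 0, put t = u / v and divide by v v^q: what remains is t t^q + t + 1 = 0, which has just
  -- been excluded. For v = 0 the equation reads u u^q = 0.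
  trivial-zero : ∀ u v → v * frob 1 v + u * (frob 1 u + frob 1 v) ≈ 0# → u ≈ 0# × v ≈ 0#
  trivial-zero u v eq with v ≟ 0#
  ... | yes v≈0 = u≈0 , v≈0
    where
    uu₁≈0 : u * frob 1 u ≈ 0#
    uu₁≈0 = begin
      u * frob 1 u ≈⟨ solve 4 (λ u u₁ v v₁ → u :* u₁ := ((v :* v₁ :+ u :* (u₁ :+ v₁)) :+ v :* v₁) :+ u :* v₁) refl u (frob 1 u) v (frob 1 v) ⟩
      ((v * frob 1 v + u * (frob 1 u + frob 1 v)) + v * frob 1 v) + u * frob 1 v
        ≈⟨ trans (absorb (trans (*-congˡ (trans (frob-cong 1 v≈0) (frob-0 1))) (zeroʳ u)))
             (absorb (trans (*-congʳ v≈0) (zeroˡ _))) ⟩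
      v * frob 1 v + u * (frob 1 u + frob 1 v) ≈⟨ eq ⟩
      0# ∎
    u≈0 : u ≈ 0#
    u≈0 with zero-product u (frob 1 u) uu₁≈0
    ... | inj₁ u≈0 = u≈0
    ... | inj₂ u₁≈0 = frob-zero u₁≈0
  ... | no v≉0 = ⊥-elim (frob-mul-contradiction t tt₁≈t+1)
    where
    v⁻¹ = proj₁ (inverse v v≉0)
    t = u * v⁻¹
    u≈tv : u ≈ t * v
    u≈tv = begin
      u               ≈⟨ *-identityʳ u ⟨
      u * 1#          ≈⟨ *-congˡ (trans (*-comm _ _) (proj₂ (inverse v v≉0))) ⟨
      u * (v⁻¹ * v)   ≈⟨ *-assoc _ _ _ ⟨
      t * v           ∎
    u₁≈t₁v₁ : frob 1 u ≈ frob 1 t * frob 1 v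
    u₁≈t₁v₁ = trans (frob-cong 1 u≈tv) (frob-* 1 t v)
    scaled : v * (frob 1 v * (t * frob 1 t + (t + 1#))) ≈ 0#
    scaled = begin
      v * (frob 1 v * (t * frob 1 t + (t + 1#)))
        ≈⟨ solve 4 (λ t t₁ v v₁ → v :* (v₁ :* (t :* t₁ :+ (t :+ con true)))
             := v :* v₁ :+ (t :* v) :* (t₁ :* v₁ :+ v₁)) refl t (frob 1 t) v (frob 1 v) ⟩
      v * frob 1 v + (t * v) * (frob 1 t * frob 1 v + frob 1 v)
        ≈⟨ +-congˡ (*-cong u≈tv (+-congʳ u₁≈t₁v₁)) ⟨
      v * frob 1 v + u * (frob 1 u + frob 1 v) ≈⟨ eq ⟩
      0# ∎
    tt₁≈t+1 : t * frob 1 t ≈ t + 1#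
    tt₁≈t+1 = x+y≈0⇒x≈y (cancel-zero (v≉0 ∘ frob-zero) (cancel-zero v≉0 scaled))

  -- The case of a plane meeting x = y = 0: there (x, y) = λ (u, v), and one further
  -- equation of the plane expresses a combination of λ^q and λ^(q²) through λ.
  semilinear-dependent : ∀ (l : Vect 4) a b d → ¬ (b ≈ 0# × d ≈ 0#) →
    (∀ j → b * frob 1 (l j) + d * frob 2 (l j) ≈ a * l j) → FqDependent {1} (λ _ → l)
  semilinear-dependent l a b d bd≉0 eq = descent (λ _ → l) α α≉0
    (recurrence-propagates-relation (λ _ → l) (λ _ _ → proj₁ recurrence) (λ _ _ → proj₁ (proj₂ recurrence))
      (λ _ j → trans (proj₂ (proj₂ recurrence) j)
        (sym (+-cong (+-identityʳ _) (+-identityʳ _)))) α (λ _ → αw≈0 0F) (λ _ → αw≈0 1F))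
    where
    -- Only two conditions are imposed on the four coefficients; the zero row pads the system to
    -- three.
    solution = underdetermined-system 3 (l ∷ (frob 1 ∘ l) ∷ 0ᵛ ∷ [])
    α = proj₁ solution
    α≉0 = proj₁ (proj₂ solution)
    αw≈0 = proj₂ (proj₂ solution)
    recurrence : ∃[ A ] ∃[ B ] (∀ j → frob 2 (l j) ≈ A * l j + B * frob 1 (l j))
    recurrence with d ≟ 0# | b ≟ 0#
    ... | no d≉0  | _ = d⁻¹ * a , d⁻¹ * b , λ j → begin
      frob 2 (l j)                ≈⟨ *-identityˡ _ ⟨
      1# * frob 2 (l j)           ≈⟨ *-congʳ dd⁻¹≈1 ⟨
      d * d⁻¹ * frob 2 (l j)
        ≈⟨ solve 5 (λ b d d⁻¹ l₁ l₂ → d :* d⁻¹ :* l₂ := d⁻¹ :* (b :* l₁ :+ d :* l₂) :+ d⁻¹ :* b :* l₁)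
             refl b d d⁻¹ (frob 1 (l j)) (frob 2 (l j)) ⟩
      d⁻¹ * (b * frob 1 (l j) + d * frob 2 (l j)) + d⁻¹ * b * frob 1 (l j)
        ≈⟨ +-congʳ (trans (*-congˡ (eq j)) (sym (*-assoc d⁻¹ a (l j)))) ⟩
      d⁻¹ * a * l j + d⁻¹ * b * frob 1 (l j) ∎
      where
      d⁻¹ = proj₁ (inverse d d≉0)
      dd⁻¹≈1 = proj₂ (inverse d d≉0)
    -- Here the equation is of first order, l^q = (a / b) l; its Frobenius conjugate has the
    -- required second-order shape.
    ... | yes d≈0 | no b≉0 = 0# , frob 1 (b⁻¹ * a) , λ j → begin
      frob 2 (l j)                          ≈⟨ frob-cong 1 (l₁≈ j) ⟩
      frob 1 (b⁻¹ * a * l j)                ≈⟨ frob-* 1 _ _ ⟩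
      frob 1 (b⁻¹ * a) * frob 1 (l j)       ≈⟨ trans (+-congʳ (zeroˡ (l j))) (+-identityˡ _) ⟨
      0# * l j + frob 1 (b⁻¹ * a) * frob 1 (l j) ∎
      where
      b⁻¹ = proj₁ (inverse b b≉0)
      bb⁻¹≈1 = proj₂ (inverse b b≉0)
      l₁≈ : ∀ j → frob 1 (l j) ≈ b⁻¹ * a * l j
      l₁≈ j = begin
        frob 1 (l j)                ≈⟨ *-identityˡ _ ⟨
        1# * frob 1 (l j)           ≈⟨ *-congʳ bb⁻¹≈1 ⟨
        b * b⁻¹ * frob 1 (l j)      ≈⟨ trans (*-congʳ (*-comm b b⁻¹)) (*-assoc b⁻¹ b _) ⟩
        b⁻¹ * (b * frob 1 (l j))    ≈⟨ *-congˡ (absorb (trans (*-congʳ d≈0) (zeroˡ _))) ⟨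
        b⁻¹ * (b * frob 1 (l j) + d * frob 2 (l j)) ≈⟨ *-congˡ (eq j) ⟩
        b⁻¹ * (a * l j)             ≈⟨ *-assoc b⁻¹ a (l j) ⟨
        b⁻¹ * a * l j               ∎
    ... | yes d≈0 | yes b≈0 = contradiction (b≈0 , d≈0) bd≉0

  all-zero-dependent : ∀ {m} (x : Fin m → Vect 4) → (∀ l j → x l j ≈ 0#) → FqDependent x
  all-zero-dependent x x≈0 = (λ _ → 1#) , (λ _ → pow-1 q) , (0F , λ eq → 0≉1 (sym eq)) ,
    λ l → ·-zeroʳ (λ _ → 1#) (x≈0 l)

  -- The vector (0, 0, n₂, n₃) stands for a nonzero vector of the plane, and `eq` evaluates n₃ z +
  -- n₂ w, the combination of the last two coordinates that annihilates it.
  module _ (x y l : Vect 4) (u v n₂ n₃ a : Carrier) (n≉0 : ¬ (n₂ ≈ 0# × n₃ ≈ 0#))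
    (x≈ : ∀ j → x j ≈ l j * u) (y≈ : ∀ j → y j ≈ l j * v)
    (eq : ∀ j → n₃ * (frob 1 (x j) + frob 2 (y j)) + n₂ * (frob 2 (x j) + frob 1 (y j) + frob 2 (y j)) ≈ a * l j)
    where

    private
      u₁ = frob 1 u
      u₂ = frob 2 u
      v₁ = frob 1 v
      v₂ = frob 2 v
      b = n₃ * u₁ + n₂ * v₁
      d = n₃ * v₂ + n₂ * (u₂ + v₂)

    reduced-equation : ∀ j → b * frob 1 (l j) + d * frob 2 (l j) ≈ a * l j
    reduced-equation j = begin
      b * l₁ + d * l₂
        ≈⟨ solve 8 (λ u₁ u₂ v₁ v₂ n₂ n₃ l₁ l₂ →
             (n₃ :* u₁ :+ n₂ :* v₁) :* l₁ :+ (n₃ :* v₂ :+ n₂ :* (u₂ :+ v₂)) :* l₂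
             := n₃ :* (l₁ :* u₁ :+ l₂ :* v₂) :+ n₂ :* (l₂ :* u₂ :+ l₁ :* v₁ :+ l₂ :* v₂))
             refl u₁ u₂ v₁ v₂ n₂ n₃ l₁ l₂ ⟩
      n₃ * (l₁ * u₁ + l₂ * v₂) + n₂ * (l₂ * u₂ + l₁ * v₁ + l₂ * v₂)
        ≈⟨ +-cong (*-congˡ (+-cong (xᵢ 1) (yᵢ 2))) (*-congˡ (+-cong (+-cong (xᵢ 2) (yᵢ 1)) (yᵢ 2))) ⟨
      n₃ * (frob 1 (x j) + frob 2 (y j)) + n₂ * (frob 2 (x j) + frob 1 (y j) + frob 2 (y j))
        ≈⟨ eq j ⟩
      a * l j ∎
      where
      l₁ = frob 1 (l j)
      l₂ = frob 2 (l j)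
      xᵢ : ∀ i → frob i (x j) ≈ frob i (l j) * frob i u
      xᵢ i = trans (frob-cong i (x≈ j)) (frob-* i (l j) u)
      yᵢ : ∀ i → frob i (y j) ≈ frob i (l j) * frob i v
      yᵢ i = trans (frob-cong i (y≈ j)) (frob-* i (l j) v)

    -- b and d are the two coordinates of the image of (n₃, n₂) under a matrix whose
    -- determinant is the q-th power of v v^q + u (u^q + v^q).
    coefficients-vanish : b ≈ 0# → d ≈ 0# → u ≈ 0# × v ≈ 0#
    coefficients-vanish b≈0 d≈0 = trivial-zero u v (frob-zero (begin
      frob 1 (v * v₁ + u * (u₁ + v₁))
        ≈⟨ trans (frob-+ 1 _ _) (+-cong (frob-* 1 v v₁) (trans (frob-* 1 u _) (*-congˡ (frob-+ 1 u₁ v₁)))) ⟩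
      v₁ * v₂ + u₁ * (u₂ + v₂) ≈⟨ determinant≈0 ⟩
      0# ∎))
      where
      combination≈0 : ∀ r s → r * b + s * d ≈ 0#
      combination≈0 r s = trans (+-cong (trans (*-congˡ b≈0) (zeroʳ r)) (trans (*-congˡ d≈0) (zeroʳ s))) (+-identityˡ 0#)
      n₂-multiple : n₂ * (v₁ * v₂ + u₁ * (u₂ + v₂)) ≈ 0#
      n₂-multiple = trans (solve 6 (λ u₁ u₂ v₁ v₂ n₂ n₃ → n₂ :* (v₁ :* v₂ :+ u₁ :* (u₂ :+ v₂))
        := v₂ :* (n₃ :* u₁ :+ n₂ :* v₁) :+ u₁ :* (n₃ :* v₂ :+ n₂ :* (u₂ :+ v₂)))
        refl u₁ u₂ v₁ v₂ n₂ n₃) (combination≈0 v₂ u₁)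
      n₃-multiple : n₃ * (v₁ * v₂ + u₁ * (u₂ + v₂)) ≈ 0#
      n₃-multiple = trans (solve 6 (λ u₁ u₂ v₁ v₂ n₂ n₃ → n₃ :* (v₁ :* v₂ :+ u₁ :* (u₂ :+ v₂))
        := (u₂ :+ v₂) :* (n₃ :* u₁ :+ n₂ :* v₁) :+ v₁ :* (n₃ :* v₂ :+ n₂ :* (u₂ :+ v₂)))
        refl u₁ u₂ v₁ v₂ n₂ n₃) (combination≈0 (u₂ + v₂) v₁)
      determinant≈0 : v₁ * v₂ + u₁ * (u₂ + v₂) ≈ 0#
      determinant≈0 with n₂ ≟ 0# | n₃ ≟ 0#
      ... | no n₂≉0 | _         = cancel-zero n₂≉0 n₂-multiple
      ... | yes _   | no n₃≉0   = cancel-zero n₃≉0 n₃-multiple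
      ... | yes n₂≈0 | yes n₃≈0 = contradiction (n₂≈0 , n₃≈0) n≉0

    multiple-dependent : FqDependent {1} (λ _ → l) → FqDependent (x ∷ y ∷ [])
    multiple-dependent (γ , γ∈Fq , γ≉0 , γl≈0) = γ , γ∈Fq , γ≉0 , λ
      { 0F → multiple x≈ ; 1F → multiple y≈ }
      where
      multiple : ∀ {z : Vect 4} {w} → (∀ j → z j ≈ l j * w) → γ · z ≈ 0#
      multiple {w = w} z≈ = trans (·-congˡ {α = γ} (λ j → trans (z≈ j) (*-comm (l j) w)))
        (·-scale-zeroʳ γ l w (γl≈0 0F))

    line-dependent : FqDependent (x ∷ y ∷ [])
    line-dependent with b ≟ 0# | d ≟ 0#
    ... | no b≉0  | _       = multiple-dependent (semilinear-dependent l a b d (b≉0 ∘ proj₁) reduced-equation)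
    ... | yes _   | no d≉0  = multiple-dependent (semilinear-dependent l a b d (d≉0 ∘ proj₂) reduced-equation)
    ... | yes b≈0 | yes d≈0 = all-zero-dependent (x ∷ y ∷ []) λ
      { 0F j → trans (x≈ j) (trans (*-congˡ (proj₁ (coefficients-vanish b≈0 d≈0))) (zeroʳ _))
      ; 1F j → trans (y≈ j) (trans (*-congˡ (proj₂ (coefficients-vanish b≈0 d≈0))) (zeroʳ _)) }

  -- Planes that are graphs over (x, y).

  -- The case of a plane given by z = a x + b y, w = c x + d y: writing vᵢ for the i-th
  -- Frobenius image of (x, y), its equations become v₂ = A v₀ + B v₁ with
  -- A = (e f; g h) and B = (1 1; 1 0). As B³ = 1, the identity v₄ = v₀ reads M v₀ + N v₁ = 0
  -- with M = A₂ A + B² A + 1 and N = A₂ B + B A₁ + 1.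
  module _ (e f g h : Carrier) where
    private
      e₁ = frob 1 e
      f₁ = frob 1 f
      g₁ = frob 1 g
      h₁ = frob 1 h
      e₂ = frob 2 e
      f₂ = frob 2 f
      g₂ = frob 2 g
      h₂ = frob 2 h

    -- The two rows of the block matrix (M | N), paired with (x, y, x^q, y^q).
    ρ₁ ρ₂ : Vect 4
    ρ₁ = (e₂ * e + f₂ * g + g + 1#) ∷ (e₂ * f + f₂ * h + h) ∷ (e₂ + f₂ + e₁ + g₁ + 1#) ∷ (e₂ + f₁ + h₁) ∷ []
    ρ₂ = (g₂ * e + h₂ * g + e + g) ∷ (g₂ * f + h₂ * h + f + h + 1#) ∷ (g₂ + h₂ + e₁) ∷ (g₂ + f₁ + 1#) ∷ []

    -- N = 0 forces A = h + g B with g^q = g + 1, and then M = 0 gives h = g² and g⁴ = g + 1.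
    nonvanishing : ¬ (ρ₁ ≈ᵛ 0ᵛ × ρ₂ ≈ᵛ 0ᵛ)
    nonvanishing (ρ₁≈0 , ρ₂≈0) = frob-shift-contradiction g g⁴≈g+1 (trans g₁≈ (+-congʳ f≈g))
      where
      -- Every entry of N is a q-th power, so injectivity of the Frobenius strips one conjugation.
      -- The four entries then express e^q, f^q, g^q, h^q as affine combinations of e, f, g, h.
      e₁≈ : e₁ ≈ f + h
      e₁≈ = x+y≈0⇒x≈y (trans (sym (+-assoc _ _ _)) (frob-zero
        (trans (trans (frob-+ 1 (e₁ + f) h) (+-congʳ (frob-+ 1 e₁ f))) (ρ₁≈0 3F))))
      g₁≈ : g₁ ≈ f + 1#
      g₁≈ = x+y≈0⇒x≈y (trans (sym (+-assoc _ _ _)) (frob-zero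
        (trans (trans (frob-+1 (g₁ + f)) (+-congʳ (frob-+ 1 g₁ f))) (ρ₂≈0 3F))))
      h₁≈ : h₁ ≈ f + 1# + e
      h₁≈ = trans (x+y≈0⇒x≈y (trans (solve 3 (λ g₁ h₁ e → h₁ :+ (g₁ :+ e) := g₁ :+ h₁ :+ e) refl g₁ h₁ e)
        (frob-zero (trans (trans (frob-+ 1 (g₁ + h₁) e) (+-congʳ (frob-+ 1 g₁ h₁))) (ρ₂≈0 2F)))))
        (+-congʳ g₁≈)
      f₁≈ : f₁ ≈ e + f + g + h + 1#
      f₁≈ = begin
        f₁                    ≈⟨ x+y≈0⇒x≈y (trans
          (solve 4 (λ e₁ f₁ e g → f₁ :+ (e₁ :+ e :+ g :+ con true) := e₁ :+ f₁ :+ e :+ g :+ con true) refl e₁ f₁ e g)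
          (frob-zero (trans (trans (frob-+1 (e₁ + f₁ + e + g)) (+-congʳ (trans (frob-+ 1 (e₁ + f₁ + e) g)
            (+-congʳ (trans (frob-+ 1 (e₁ + f₁) e) (+-congʳ (frob-+ 1 e₁ f₁))))))) (ρ₁≈0 2F)))) ⟩
        e₁ + e + g + 1#       ≈⟨ +-congʳ (+-congʳ (+-congʳ e₁≈)) ⟩
        f + h + e + g + 1#    ≈⟨ solve 4 (λ e f g h → f :+ h :+ e :+ g :+ con true := e :+ f :+ g :+ h :+ con true) refl e f g h ⟩
        e + f + g + h + 1#    ∎
      e₂≈ : e₂ ≈ g + h
      e₂≈ = begin
        e₂                                    ≈⟨ frob-cong 1 e₁≈ ⟩
        frob 1 (f + h)                        ≈⟨ frob-+ 1 f h ⟩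
        f₁ + h₁                               ≈⟨ +-cong f₁≈ h₁≈ ⟩
        (e + f + g + h + 1#) + (f + 1# + e)   ≈⟨ solve 4 (λ e f g h → (e :+ f :+ g :+ h :+ con true) :+ (f :+ con true :+ e) := g :+ h) refl e f g h ⟩
        g + h                                 ∎
      g₂≈ : g₂ ≈ e + f + g + h
      g₂≈ = begin
        g₂                        ≈⟨ frob-cong 1 g₁≈ ⟩
        frob 1 (f + 1#)           ≈⟨ frob-+1 f ⟩
        f₁ + 1#                   ≈⟨ +-congʳ f₁≈ ⟩
        e + f + g + h + 1# + 1#   ≈⟨ solve 4 (λ e f g h → e :+ f :+ g :+ h :+ con true :+ con true := e :+ f :+ g :+ h) refl e f g h ⟩
        e + f + g + h             ∎
      h₂≈ : h₂ ≈ e + g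
      h₂≈ = begin
        h₂                                          ≈⟨ frob-cong 1 h₁≈ ⟩
        frob 1 (f + 1# + e)                         ≈⟨ trans (frob-+ 1 (f + 1#) e) (+-congʳ (frob-+1 f)) ⟩
        f₁ + 1# + e₁                                ≈⟨ +-cong (+-congʳ f₁≈) e₁≈ ⟩
        (e + f + g + h + 1#) + 1# + (f + h)         ≈⟨ solve 4 (λ e f g h → (e :+ f :+ g :+ h :+ con true) :+ con true :+ (f :+ h) := e :+ g) refl e f g h ⟩
        e + g                                       ∎
      f₂≈ : f₂ ≈ g
      f₂≈ = begin
        f₂                          ≈⟨ frob-cong 1 f₁≈ ⟩
        frob 1 (e + f + g + h + 1#) ≈⟨ trans (frob-+1 (e + f + g + h)) (+-congʳ (trans (frob-+ 1 (e + f + g) h)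
                                        (+-congʳ (trans (frob-+ 1 (e + f) g) (+-congʳ (frob-+ 1 e f)))))) ⟩
        e₁ + f₁ + g₁ + h₁ + 1#      ≈⟨ +-congʳ (+-cong (+-cong (+-cong e₁≈ f₁≈) g₁≈) h₁≈) ⟩
        (f + h) + (e + f + g + h + 1#) + (f + 1#) + (f + 1# + e) + 1#
          ≈⟨ solve 4 (λ e f g h → (f :+ h) :+ (e :+ f :+ g :+ h :+ con true) :+ (f :+ con true) :+ (f :+ con true :+ e) :+ con true := g) refl e f g h ⟩
        g                           ∎
      -- The q²-power now acts on e, f, g, h by an explicit linear substitution, whose square must
      -- fix them; its e- and f-coordinates give e = f + h and f = g.
      e≈f+h : e ≈ f + h
      e≈f+h = begin
        e                          ≈⟨ frob-period e ⟨
        frob 2 e₂                  ≈⟨ frob-cong 2 e₂≈ ⟩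
        frob 2 (g + h)             ≈⟨ frob-+ 2 g h ⟩
        g₂ + h₂                    ≈⟨ +-cong g₂≈ h₂≈ ⟩
        (e + f + g + h) + (e + g)  ≈⟨ solve 4 (λ e f g h → (e :+ f :+ g :+ h) :+ (e :+ g) := f :+ h) refl e f g h ⟩
        f + h                      ∎
      f≈g : f ≈ g
      f≈g = begin
        f                  ≈⟨ frob-period f ⟨
        frob 2 f₂          ≈⟨ frob-cong 2 f₂≈ ⟩
        g₂                 ≈⟨ g₂≈ ⟩
        e + f + g + h      ≈⟨ +-congʳ (+-congʳ (+-congʳ e≈f+h)) ⟩
        (f + h) + f + g + h ≈⟨ solve 3 (λ f g h → (f :+ h) :+ f :+ g :+ h := g) refl f g h ⟩
        g                  ∎
      e≈g+h : e ≈ g + h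
      e≈g+h = trans e≈f+h (+-congʳ f≈g)
      h≈g² : h ≈ g * g
      h≈g² = x+y≈0⇒x≈y (begin
        h + g * g                     ≈⟨ solve 2 (λ g h → h :+ g :* g := (g :+ h) :* g :+ g :* h :+ h) refl g h ⟩
        (g + h) * g + g * h + h       ≈⟨ +-congʳ (+-cong (*-cong e₂≈ f≈g) (*-congʳ f₂≈)) ⟨
        e₂ * f + f₂ * h + h           ≈⟨ ρ₁≈0 1F ⟩
        0#                            ∎)
      g⁴≈g+1 : (g * g) * (g * g) ≈ g + 1#
      g⁴≈g+1 = x+y≈0⇒x≈y (begin
        (g * g) * (g * g) + (g + 1#)           ≈⟨ +-congʳ (*-cong h≈g² h≈g²) ⟨
        h * h + (g + 1#)                       ≈⟨ solve 2 (λ g h → h :* h :+ (g :+ con true) := (g :+ h) :* (g :+ h) :+ g :* g :+ g :+ con true) refl g h ⟩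
        (g + h) * (g + h) + g * g + g + 1#     ≈⟨ +-congʳ (+-congʳ (+-cong (*-cong e₂≈ e≈g+h) (*-congʳ f₂≈))) ⟨
        e₂ * e + f₂ * g + g + 1#               ≈⟨ ρ₁≈0 0F ⟩
        0#                                     ∎)

    module _ {x y : Carrier} (x₂≈ : frob 2 x ≈ e * x + f * y + frob 1 x + frob 1 y)
                             (y₂≈ : frob 2 y ≈ g * x + h * y + frob 1 x) where
      private
        x₁ = frob 1 x
        y₁ = frob 1 y
        x₂ = frob 2 x
        y₂ = frob 2 y
        x₃ = frob 3 x
        y₃ = frob 3 y

      frob-bilinear : ∀ a b s t → frob 1 (a * s + b * t) ≈ frob 1 a * frob 1 s + frob 1 b * frob 1 t
      frob-bilinear a b s t = trans (frob-+ 1 (a * s) (b * t)) (+-cong (frob-* 1 a s) (frob-* 1 b t))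

      x₃≈ : x₃ ≈ e₁ * x₁ + f₁ * y₁ + x₂ + y₂
      x₃≈ = trans (frob-cong 1 x₂≈) (trans (frob-+ 1 _ _) (+-congʳ (trans (frob-+ 1 _ _) (+-congʳ (frob-bilinear e f x y)))))
      y₃≈ : y₃ ≈ g₁ * x₁ + h₁ * y₁ + x₂
      y₃≈ = trans (frob-cong 1 y₂≈) (trans (frob-+ 1 _ _) (+-congʳ (frob-bilinear g h x y)))
      x₄≈ : frob 4 x ≈ e₂ * x₂ + f₂ * y₂ + x₃ + y₃
      x₄≈ = trans (frob-cong 1 x₃≈) (trans (frob-+ 1 _ _) (+-congʳ (trans (frob-+ 1 _ _) (+-congʳ (frob-bilinear e₁ f₁ x₁ y₁)))))
      y₄≈ : frob 4 y ≈ g₂ * x₂ + h₂ * y₂ + x₃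
      y₄≈ = trans (frob-cong 1 y₃≈) (trans (frob-+ 1 _ _) (+-congʳ (frob-bilinear g₁ h₁ x₁ y₁)))

      window : Vect 4
      window = x ∷ y ∷ x₁ ∷ y₁ ∷ []

      -- Unrolls x^(q⁴) through the recurrence until only the entries of `window` remain, and
      -- equates the result with x. The trailing `con false` in the solver call is the empty tail of
      -- the dot product.
      ρ₁-equation : ρ₁ · window ≈ 0#
      ρ₁-equation = begin
        ρ₁ · window
          ≈⟨ solve 14 (λ e f g h e₁ f₁ g₁ h₁ e₂ f₂ x y x₁ y₁ →
               (e₂ :* e :+ f₂ :* g :+ g :+ con true) :* x :+ ((e₂ :* f :+ f₂ :* h :+ h) :* y
                 :+ ((e₂ :+ f₂ :+ e₁ :+ g₁ :+ con true) :* x₁ :+ ((e₂ :+ f₁ :+ h₁) :* y₁ :+ con false)))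
               := e₂ :* (e :* x :+ f :* y :+ x₁ :+ y₁) :+ f₂ :* (g :* x :+ h :* y :+ x₁)
                  :+ (e₁ :* x₁ :+ f₁ :* y₁ :+ (e :* x :+ f :* y :+ x₁ :+ y₁) :+ (g :* x :+ h :* y :+ x₁))
                  :+ (g₁ :* x₁ :+ h₁ :* y₁ :+ (e :* x :+ f :* y :+ x₁ :+ y₁)) :+ x)
               refl e f g h e₁ f₁ g₁ h₁ e₂ f₂ x y x₁ y₁ ⟩
        e₂ * x₂′ + f₂ * y₂′ + (e₁ * x₁ + f₁ * y₁ + x₂′ + y₂′) + (g₁ * x₁ + h₁ * y₁ + x₂′) + x
          ≈⟨ +-congʳ (+-cong (+-cong (+-cong (*-congˡ x₂≈) (*-congˡ y₂≈)) (+-cong (+-congˡ x₂≈) y₂≈)) (+-congˡ x₂≈)) ⟨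
        e₂ * x₂ + f₂ * y₂ + (e₁ * x₁ + f₁ * y₁ + x₂ + y₂) + (g₁ * x₁ + h₁ * y₁ + x₂) + x
          ≈⟨ +-congʳ (+-cong (+-congˡ x₃≈) y₃≈) ⟨
        e₂ * x₂ + f₂ * y₂ + x₃ + y₃ + x
          ≈⟨ x≈y⇒x+y≈0 (trans (sym x₄≈) (frob-period x)) ⟩
        0# ∎
        where
        x₂′ = e * x + f * y + x₁ + y₁
        y₂′ = g * x + h * y + x₁

      ρ₂-equation : ρ₂ · window ≈ 0#
      ρ₂-equation = begin
        ρ₂ · window
          ≈⟨ solve 12 (λ e f g h e₁ f₁ g₂ h₂ x y x₁ y₁ →
               (g₂ :* e :+ h₂ :* g :+ e :+ g) :* x :+ ((g₂ :* f :+ h₂ :* h :+ f :+ h :+ con true) :* y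
                 :+ ((g₂ :+ h₂ :+ e₁) :* x₁ :+ ((g₂ :+ f₁ :+ con true) :* y₁ :+ con false)))
               := g₂ :* (e :* x :+ f :* y :+ x₁ :+ y₁) :+ h₂ :* (g :* x :+ h :* y :+ x₁)
                  :+ (e₁ :* x₁ :+ f₁ :* y₁ :+ (e :* x :+ f :* y :+ x₁ :+ y₁) :+ (g :* x :+ h :* y :+ x₁)) :+ y)
               refl e f g h e₁ f₁ g₂ h₂ x y x₁ y₁ ⟩
        g₂ * x₂′ + h₂ * y₂′ + (e₁ * x₁ + f₁ * y₁ + x₂′ + y₂′) + y
          ≈⟨ +-congʳ (+-cong (+-cong (*-congˡ x₂≈) (*-congˡ y₂≈)) (+-cong (+-congˡ x₂≈) y₂≈)) ⟨
        g₂ * x₂ + h₂ * y₂ + (e₁ * x₁ + f₁ * y₁ + x₂ + y₂) + y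
          ≈⟨ +-congʳ (+-congˡ x₃≈) ⟨
        g₂ * x₂ + h₂ * y₂ + x₃ + y
          ≈⟨ x≈y⇒x+y≈0 (trans (sym y₄≈) (frob-period y)) ⟩
        0# ∎
        where
        x₂′ = e * x + f * y + x₁ + y₁
        y₂′ = g * x + h * y + x₁

    recurrence-dependent : ∀ (x y : Vect 4) →
      (∀ j → frob 2 (x j) ≈ e * x j + f * y j + frob 1 (x j) + frob 1 (y j)) →
      (∀ j → frob 2 (y j) ≈ g * x j + h * y j + frob 1 (x j)) →
      FqDependent (x ∷ y ∷ [])
    recurrence-dependent x y x₂≈ y₂≈ = descent (x ∷ y ∷ []) α α≉0
      (recurrence-propagates-relation (x ∷ y ∷ []) A B rec α
        (λ { 0F → αw≈0 0F ; 1F → αw≈0 1F }) (λ { 0F → αw≈0 2F ; 1F → αw≈0 3F }))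
      where
      -- A square matrix with rows x, y, x^q, y^q and one column per point. A relation among its
      -- rows, `ρ₁` or `ρ₂`, makes it singular and so yields a relation `α` among its columns.
      w : Fin 4 → Vect 4
      w i j = window (x₂≈ j) (y₂≈ j) i
      relation : ∃[ α ] (Nontrivial α × (∀ i → α · w i ≈ 0#))
      relation with zero-or-nontrivial ρ₁ | zero-or-nontrivial ρ₂
      ... | inj₂ ρ₁≉0 | _         = singular-system 3 ρ₁ ρ₁≉0 w (λ j → ρ₁-equation (x₂≈ j) (y₂≈ j))
      ... | inj₁ _    | inj₂ ρ₂≉0 = singular-system 3 ρ₂ ρ₂≉0 w (λ j → ρ₂-equation (x₂≈ j) (y₂≈ j))
      ... | inj₁ ρ₁≈0 | inj₁ ρ₂≈0 = contradiction (ρ₁≈0 , ρ₂≈0) nonvanishing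
      α = proj₁ relation
      α≉0 = proj₁ (proj₂ relation)
      αw≈0 = proj₂ (proj₂ relation)
      A B : Fin 2 → Vect 2
      A = (e ∷ f ∷ []) ∷ (g ∷ h ∷ []) ∷ []
      B = (1# ∷ 1# ∷ []) ∷ (1# ∷ 0# ∷ []) ∷ []
      rec : ∀ l j → frob 2 ((x ∷ y ∷ []) l j) ≈
        A l · (λ r → (x ∷ y ∷ []) r j) + B l · (λ r → frob 1 ((x ∷ y ∷ []) r j))
      rec 0F j = trans (x₂≈ j) (solve 6 (λ e f x y x₁ y₁ → e :* x :+ f :* y :+ x₁ :+ y₁
        := (e :* x :+ (f :* y :+ con false)) :+ (con true :* x₁ :+ (con true :* y₁ :+ con false)))
        refl e f (x j) (y j) (frob 1 (x j)) (frob 1 (y j)))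
      rec 1F j = trans (y₂≈ j) (solve 6 (λ g h x y x₁ y₁ → g :* x :+ h :* y :+ x₁
        := (g :* x :+ (h :* y :+ con false)) :+ (con true :* x₁ :+ (con false :* y₁ :+ con false)))
        refl g h (x j) (y j) (frob 1 (x j)) (frob 1 (y j)))

  -- The first equation isolates y^(q²), and the sum of both isolates x^(q²) because y^(q²) cancels;
  -- so A has rows (a + c, b + d) and (a, b).
  graph-dependent : ∀ (x y : Vect 4) a b c d →
    (∀ j → frob 1 (x j) + frob 2 (y j) ≈ a * x j + b * y j) →
    (∀ j → frob 2 (x j) + frob 1 (y j) + frob 2 (y j) ≈ c * x j + d * y j) →
    FqDependent (x ∷ y ∷ [])
  graph-dependent x y a b c d z≈ w≈ = recurrence-dependent (a + c) (b + d) a b x y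
    (λ j → begin
      frob 2 (x j)
        ≈⟨ solve 4 (λ x₁ x₂ y₁ y₂ → x₂ := (x₁ :+ y₂) :+ (x₂ :+ y₁ :+ y₂) :+ x₁ :+ y₁)
             refl (frob 1 (x j)) (frob 2 (x j)) (frob 1 (y j)) (frob 2 (y j)) ⟩
      (frob 1 (x j) + frob 2 (y j)) + (frob 2 (x j) + frob 1 (y j) + frob 2 (y j)) + frob 1 (x j) + frob 1 (y j)
        ≈⟨ +-congʳ (+-congʳ (+-cong (z≈ j) (w≈ j))) ⟩
      (a * x j + b * y j) + (c * x j + d * y j) + frob 1 (x j) + frob 1 (y j)
        ≈⟨ +-congʳ (+-congʳ (solve 6 (λ a b c d x y → (a :* x :+ b :* y) :+ (c :* x :+ d :* y)
             := (a :+ c) :* x :+ (b :+ d) :* y) refl a b c d (x j) (y j))) ⟩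
      (a + c) * x j + (b + d) * y j + frob 1 (x j) + frob 1 (y j) ∎)
    (λ j → begin
      frob 2 (y j)
        ≈⟨ solve 2 (λ x₁ y₂ → y₂ := x₁ :+ y₂ :+ x₁) refl (frob 1 (x j)) (frob 2 (y j)) ⟩
      frob 1 (x j) + frob 2 (y j) + frob 1 (x j)  ≈⟨ +-congʳ (z≈ j) ⟩
      a * x j + b * y j + frob 1 (x j)            ∎)

  -- Case distinction on the plane and the conclusion for U.

  -- Point `j` of U, with parameters `x j` and `y j`, has coordinates `s j` and `t j` with respect
  -- to the spanning vectors `p` and `r`.
  record InPlane (p r x y s t : Vect 4) : Set ℓ where
    field
      x≈ : ∀ j → x j ≈ s j * p 0F + t j * r 0F
      y≈ : ∀ j → y j ≈ s j * p 1F + t j * r 1F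
      z≈ : ∀ j → frob 1 (x j) + frob 2 (y j) ≈ s j * p 2F + t j * r 2F
      w≈ : ∀ j → frob 2 (x j) + frob 1 (y j) + frob 2 (y j) ≈ s j * p 3F + t j * r 3F

  swap-InPlane : ∀ {p r x y s t} → InPlane p r x y s t → InPlane r p x y t s
  swap-InPlane plane = record
    { x≈ = λ j → trans (x≈ j) (+-comm _ _)
    ; y≈ = λ j → trans (y≈ j) (+-comm _ _)
    ; z≈ = λ j → trans (z≈ j) (+-comm _ _)
    ; w≈ = λ j → trans (w≈ j) (+-comm _ _) }
    where open InPlane plane

  module _ {p r x y s t : Vect 4} (plane : InPlane p r x y s t) where
    open InPlane plane

    -- The determinant being nonzero, (x, y) determines (s, t) by Cramer's rule, so the plane is a
    -- graph over (x, y).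
    transversal-dependent : ¬ (p 0F * r 1F + p 1F * r 0F ≈ 0#) → FqDependent (x ∷ y ∷ [])
    transversal-dependent D≉0 = graph-dependent x y _ _ _ _
      (λ j → trans (z≈ j) (cramer 2F j)) (λ j → trans (w≈ j) (cramer 3F j))
      where
      D = p 0F * r 1F + p 1F * r 0F
      D⁻¹ = proj₁ (inverse D D≉0)
      cramer : ∀ i j → s j * p i + t j * r i ≈
        D⁻¹ * (p i * r 1F + r i * p 1F) * x j + D⁻¹ * (p i * r 0F + r i * p 0F) * y j
      cramer i j = begin
        s j * p i + t j * r i
          ≈⟨ trans (*-congʳ (proj₂ (inverse D D≉0))) (*-identityˡ _) ⟨
        D * D⁻¹ * (s j * p i + t j * r i)
          ≈⟨ solve 9 (λ p₀ p₁ r₀ r₁ pᵢ rᵢ s t D⁻¹ →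
               (p₀ :* r₁ :+ p₁ :* r₀) :* D⁻¹ :* (s :* pᵢ :+ t :* rᵢ)
               := D⁻¹ :* (pᵢ :* r₁ :+ rᵢ :* p₁) :* (s :* p₀ :+ t :* r₀)
                  :+ D⁻¹ :* (pᵢ :* r₀ :+ rᵢ :* p₀) :* (s :* p₁ :+ t :* r₁))
               refl (p 0F) (p 1F) (r 0F) (r 1F) (p i) (r i) (s j) (t j) D⁻¹ ⟩
        D⁻¹ * (p i * r 1F + r i * p 1F) * (s j * p 0F + t j * r 0F)
          + D⁻¹ * (p i * r 0F + r i * p 0F) * (s j * p 1F + t j * r 1F)
          ≈⟨ +-cong (*-congˡ (x≈ j)) (*-congˡ (y≈ j)) ⟨
        D⁻¹ * (p i * r 1F + r i * p 1F) * x j + D⁻¹ * (p i * r 0F + r i * p 0F) * y j ∎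

    -- The vector s₀ p + t₀ r has x = y = 0, so the first two coordinates of p are those of r times
    -- t₀ / s₀. Hence each (x, y) is a multiple of the one pair s₀⁻¹ (r₀, r₁), with multiplier l =
    -- s₀ t + t₀ s.
    vertical-dependent : ∀ s₀ t₀ → ¬ (s₀ ≈ 0#) →
      s₀ * p 0F + t₀ * r 0F ≈ 0# → s₀ * p 1F + t₀ * r 1F ≈ 0# →
      ¬ (s₀ * p 2F + t₀ * r 2F ≈ 0# × s₀ * p 3F + t₀ * r 3F ≈ 0#) →
      FqDependent (x ∷ y ∷ [])
    vertical-dependent s₀ t₀ s₀≉0 n₀≈0 n₁≈0 n≉0 = line-dependent x y l (s₀⁻¹ * r 0F) (s₀⁻¹ * r 1F) _ _
      (p 3F * r 2F + p 2F * r 3F) n≉0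
      (λ j → trans (x≈ j) (multiple 0F n₀≈0 j)) (λ j → trans (y≈ j) (multiple 1F n₁≈0 j))
      (λ j → trans (+-cong (*-congˡ (z≈ j)) (*-congˡ (w≈ j)))
        (solve 8 (λ p₂ p₃ r₂ r₃ s t s₀ t₀ →
          (s₀ :* p₃ :+ t₀ :* r₃) :* (s :* p₂ :+ t :* r₂) :+ (s₀ :* p₂ :+ t₀ :* r₂) :* (s :* p₃ :+ t :* r₃)
          := (p₃ :* r₂ :+ p₂ :* r₃) :* (s₀ :* t :+ t₀ :* s))
          refl (p 2F) (p 3F) (r 2F) (r 3F) (s j) (t j) s₀ t₀))
      where
      s₀⁻¹ = proj₁ (inverse s₀ s₀≉0)
      l : Vect 4
      l j = s₀ * t j + t₀ * s j
      multiple : ∀ i → s₀ * p i + t₀ * r i ≈ 0# → ∀ j → s j * p i + t j * r i ≈ l j * (s₀⁻¹ * r i)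
      multiple i nᵢ≈0 j = begin
        s j * p i + t j * r i
          ≈⟨ trans (*-congʳ (proj₂ (inverse s₀ s₀≉0))) (*-identityˡ _) ⟨
        s₀ * s₀⁻¹ * (s j * p i + t j * r i)
          ≈⟨ solve 7 (λ p r s t s₀ t₀ s₀⁻¹ → s₀ :* s₀⁻¹ :* (s :* p :+ t :* r)
               := (s₀ :* t :+ t₀ :* s) :* (s₀⁻¹ :* r) :+ s₀⁻¹ :* s :* (s₀ :* p :+ t₀ :* r))
               refl (p i) (r i) (s j) (t j) s₀ t₀ s₀⁻¹ ⟩
        l j * (s₀⁻¹ * r i) + s₀⁻¹ * s j * (s₀ * p i + t₀ * r i)
          ≈⟨ absorb (trans (*-congˡ nᵢ≈0) (zeroʳ _)) ⟩
        l j * (s₀⁻¹ * r i) ∎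

  lincomb₂ : ∀ {n} (b : Fin 2 → Vect n) α i → lincomb α b i ≈ α 0F * b 0F i + α 1F * b 1F i
  lincomb₂ b α i = +-congˡ (+-identityʳ _)

  plane-dependent : ∀ (b : Fin 2 → Vect 4) → LinIndep b → ∀ {x y s t} →
    InPlane (b 0F) (b 1F) x y s t → FqDependent (x ∷ y ∷ [])
  plane-dependent b indep {x} {y} {s} {t} plane with (b 0F 0F * b 1F 1F + b 0F 1F * b 1F 0F) ≟ 0#
  ... | no D≉0 = transversal-dependent plane D≉0
  -- With zero determinant, the coefficients (b₁₁, b₀₁) and likewise (b₁₀, b₀₀) combine the two
  -- basis vectors into one with x = y = 0. If both pairs are zero, x and y vanish on the whole
  -- plane.
  ... | yes D≈0 = by-pivot (zero-or-nontrivial (b 1F 1F ∷ b 0F 1F ∷ [])) (zero-or-nontrivial (b 1F 0F ∷ b 0F 0F ∷ []))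
    where
    vertical : ∀ α → Nontrivial α → α 0F * b 0F 0F + α 1F * b 1F 0F ≈ 0# →
      α 0F * b 0F 1F + α 1F * b 1F 1F ≈ 0# → FqDependent (x ∷ y ∷ [])
    vertical α α≉0 n₀≈0 n₁≈0 = dispatch α≉0
      where
      -- Linear independence of the basis keeps the vector with x = y = 0 from vanishing altogether.
      n≉0 : ¬ (α 0F * b 0F 2F + α 1F * b 1F 2F ≈ 0# × α 0F * b 0F 3F + α 1F * b 1F 3F ≈ 0#)
      n≉0 (n₂≈0 , n₃≈0) = proj₂ α≉0 (indep α (λ
        { 0F → trans (lincomb₂ b α 0F) n₀≈0
        ; 1F → trans (lincomb₂ b α 1F) n₁≈0
        ; 2F → trans (lincomb₂ b α 2F) n₂≈0
        ; 3F → trans (lincomb₂ b α 3F) n₃≈0 }) (proj₁ α≉0))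
      dispatch : Nontrivial α → FqDependent (x ∷ y ∷ [])
      dispatch (0F , α₀≉0) = vertical-dependent plane (α 0F) (α 1F) α₀≉0 n₀≈0 n₁≈0 n≉0
      dispatch (1F , α₁≉0) = vertical-dependent (swap-InPlane plane) (α 1F) (α 0F) α₁≉0
        (trans (+-comm _ _) n₀≈0) (trans (+-comm _ _) n₁≈0)
        (λ (n₂≈0 , n₃≈0) → n≉0 (trans (+-comm _ _) n₂≈0 , trans (+-comm _ _) n₃≈0))
    commutator : ∀ a c → c * a + a * c ≈ 0#
    commutator = solve 2 (λ a c → c :* a :+ a :* c := con false) refl
    by-pivot : (b 1F 1F ∷ b 0F 1F ∷ []) ≈ᵛ 0ᵛ ⊎ Nontrivial (b 1F 1F ∷ b 0F 1F ∷ []) →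
               (b 1F 0F ∷ b 0F 0F ∷ []) ≈ᵛ 0ᵛ ⊎ Nontrivial (b 1F 0F ∷ b 0F 0F ∷ []) →
               FqDependent (x ∷ y ∷ [])
    by-pivot (inj₂ α≉0) _ = vertical _ α≉0
      (trans (+-congʳ (*-comm _ _)) D≈0) (commutator _ _)
    by-pivot _ (inj₂ α≉0) = vertical _ α≉0 (commutator _ _)
      (trans (trans (+-cong (*-comm _ _) refl) (+-comm _ _)) D≈0)
    by-pivot (inj₁ b₁≈0) (inj₁ b₀≈0) = all-zero-dependent (x ∷ y ∷ []) λ
      { 0F j → trans (x≈ j) (vanish (b₀≈0 1F) (b₀≈0 0F))
      ; 1F j → trans (y≈ j) (vanish (b₁≈0 1F) (b₁≈0 0F)) }
      where
      open InPlane plane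
      vanish : ∀ {a a′ d d′} → a ≈ 0# → d ≈ 0# → a′ * a + d′ * d ≈ 0#
      vanish a≈0 d≈0 = trans (+-cong (trans (*-congˡ a≈0) (zeroʳ _)) (trans (*-congˡ d≈0) (zeroʳ _))) (+-identityˡ 0#)

  open PaperU K q using (U; uVec)

  frob-2 : ∀ x → pow x (q ℕ.* q) ≈ frob 2 x
  frob-2 x = sym (pow-pow x q q)

  U-evasive : Evasive q 4 U 2 3
  U-evasive b indep v v∈U∩H = conclude (plane-dependent b indep plane)
    where
    x y s t : Vect 4
    x j = proj₁ (proj₁ (v∈U∩H j))
    y j = proj₁ (proj₂ (proj₁ (v∈U∩H j)))
    s j = proj₁ (proj₂ (v∈U∩H j)) 0F
    t j = proj₁ (proj₂ (v∈U∩H j)) 1F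
    v≈u : ∀ j → v j ≈ᵛ uVec (x j) (y j)
    v≈u j = proj₂ (proj₂ (proj₁ (v∈U∩H j)))
    u≈span : ∀ j i → uVec (x j) (y j) i ≈ s j * b 0F i + t j * b 1F i
    u≈span j i = trans (sym (v≈u j i)) (trans (proj₂ (proj₂ (v∈U∩H j)) i) (lincomb₂ b (proj₁ (proj₂ (v∈U∩H j))) i))
    u₂≈ : ∀ j → uVec (x j) (y j) 2F ≈ frob 1 (x j) + frob 2 (y j)
    u₂≈ j = +-congˡ (frob-2 (y j))
    u₃≈ : ∀ j → uVec (x j) (y j) 3F ≈ frob 2 (x j) + frob 1 (y j) + frob 2 (y j)
    u₃≈ j = +-cong (+-congʳ (frob-2 (x j))) (frob-2 (y j))
    plane : InPlane (b 0F) (b 1F) x y s t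
    plane = record
      { x≈ = λ j → u≈span j 0F
      ; y≈ = λ j → u≈span j 1F
      ; z≈ = λ j → trans (sym (u₂≈ j)) (u≈span j 2F)
      ; w≈ = λ j → trans (sym (u₃≈ j)) (u≈span j 3F) }
    conclude : FqDependent (x ∷ y ∷ []) →
      ∃[ γ ] ((∀ j → InFq q (γ j)) × (∃[ j ] ¬ (γ j ≈ 0#)) × (lincomb γ v ≈ᵛ 0ᵛ))
    conclude (γ , γ∈Fq , γ≉0 , γxy≈0) = γ , γ∈Fq , γ≉0 , λ i →
      trans (lincomb-· γ v i) (trans (·-congˡ {α = γ} (λ j → v≈u j i)) (component i))
      where
      -- All coordinates of `uVec` are sums of Frobenius images of x and y, and `γ` has entries in
      -- 𝔽_q, so a relation on x and y extends to the whole vectors.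
      γxᵢ≈0 : ∀ i → γ · (frob i ∘ x) ≈ 0#
      γxᵢ≈0 i = frob-·-fixed i γ x γ∈Fq (γxy≈0 0F)
      γyᵢ≈0 : ∀ i → γ · (frob i ∘ y) ≈ 0#
      γyᵢ≈0 i = frob-·-fixed i γ y γ∈Fq (γxy≈0 1F)
      component : ∀ i → γ · (λ j → uVec (x j) (y j) i) ≈ 0#
      component 0F = γxᵢ≈0 0
      component 1F = γyᵢ≈0 0
      component 2F = trans (·-congˡ {α = γ} u₂≈) (·-sum-zeroʳ γ (frob 1 ∘ x) (frob 2 ∘ y) (γxᵢ≈0 1) (γyᵢ≈0 2))
      component 3F = trans (·-congˡ {α = γ} u₃≈)
        (·-sum-zeroʳ γ ((frob 2 ∘ x) +ᵛ (frob 1 ∘ y)) (frob 2 ∘ y)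
          (·-sum-zeroʳ γ (frob 2 ∘ x) (frob 1 ∘ y) (γxᵢ≈0 2) (γyᵢ≈0 1)) (γyᵢ≈0 2))

open import Data.Nat using (_*_; _^_)

theorem4p5 : ∀ {c ℓ : Level} (K : Field c ℓ) (h : ℕ) →
    ∃[ k ] (h ≡ suc (2 * k)) →
    HasCard K ((2 ^ h) ^ 4) →
    FieldOps.Evasive K (2 ^ h) 4 (PaperU.U K (2 ^ h)) 2 3
theorem4p5 K _ (k , ≡.refl) card = Evasiveness.U-evasive K k card
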